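{- Let $q$ be a prime power, $n\ge 2$, $\sigma$ a generator of $\mathrm{Gal}(\mathbb{F}_{q^n}/\mathbb{F}_q)$, and $L(x)=ax+bx^{\sigma}+cx^{\sigma^2}\in\mathbb{F}_{q^n}[x]$ with $ac\neq 0$. Let $u$ and the sequence $(G_k)$ be as in the context. Then: (i) $L$ has $q^2$ roots in $\mathbb{F}_{q^n}$ if and only if $G_{n-1}=0$ and $N(b/c)G_n=1$; (ii) $L$ has $q$ roots in $\mathbb{F}_{q^n}$ if and only if $1-N(b/c)\big(G_n+G_n^{\sigma}+G_{n-1}^{\sigma}\big)+N(a/c)=0$ and the conditions of (i) are not satisfied; (iii) $L$ has exactly $1$ root in $\mathbb{F}_{q^n}$ if and only if $1-N(b/c)\big(G_n+G_n^{\sigma}+G_{n-1}^{\sigma}\big)+N(a/c)\neq 0$.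
   Context: $N(x)=x^{1+\sigma+\dots+\sigma^{n-1}}$ is the norm $\mathbb{F}_{q^n}\to\mathbb{F}_q$. Set $u=\frac{a^{\sigma}c}{b^{\sigma+1}}$ and define $G_0=1$, $G_1=-1$, and $G_k=-G_{k-1}-u^{\sigma^{k-2}}G_{k-2}$ for $k\ge2$ (so $G_2=1-u$, $G_3=u^\sigma+u-1$, ...). Roots are counted in $\mathbb{F}_{q^n}$. Convention of the paper: $u$ and the $G_k$ are handled as formal expressions in $a,b,c$ and their $\sigma$-conjugates; when $b\neq0$ all expressions are literal, and in general every expression is evaluated only after clearing denominators involving $b$. In particular $N(b/c)G_n$ and $N(b/c)(G_n+G_n^\sigma+G_{n-1}^\sigma)$ are polynomial expressions in $a,b,1/c$ and their conjugates, and the condition $G_{n-1}=0$ is read as the vanishing of the polynomial expression $(b/c)^{1+\sigma+\dots+\sigma^{n-2}}G_{n-1}$. -}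

module Defs where

open import Level using (_⊔_)
open import Algebra.Bundles using (CommutativeRing)
open import Data.Nat as ℕ using (ℕ; zero; suc; _<_; _≤_)
open import Data.Nat.Primality using (Prime)
open import Data.List using (List; length)
open import Data.List.Relation.Unary.All using (All)
open import Data.List.Relation.Unary.Any using (Any)
open import Data.List.Relation.Unary.AllPairs using (AllPairs)
open import Data.Product using (Σ; ∃; _×_)
open import Relation.Nullary using (¬_)
open import Relation.Binary.PropositionalEquality using (_≡_)

IsPrimePower : ℕ → Set
IsPrimePower q = Σ ℕ λ p → Σ ℕ λ k → Prime p × 1 ≤ k × q ≡ p ℕ.^ k

module Setup {c ℓ} (R : CommutativeRing c ℓ) where
  open CommutativeRing R

  IsField : Set (c ⊔ ℓ)
  IsField = (¬ (1# ≈ 0#)) × (∀ x → ¬ (x ≈ 0#) → ∃ λ y → x * y ≈ 1#)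

  pow : Carrier → ℕ → Carrier
  pow x zero = 1#
  pow x (suc k) = x * pow x k

  iter : (Carrier → Carrier) → ℕ → Carrier → Carrier
  iter f zero x = x
  iter f (suc k) x = f (iter f k x)

  HasExactly : ℕ → (Carrier → Set ℓ) → Set (c ⊔ ℓ)
  HasExactly m P = Σ (List Carrier) λ xs →
      length xs ≡ m
    × All P xs
    × AllPairs (λ x y → ¬ (x ≈ y)) xs
    × (∀ x → P x → Any (x ≈_) xs)

  IsFiniteFieldOfSize : ℕ → Set (c ⊔ ℓ)
  IsFiniteFieldOfSize m = IsField × HasExactly m (λ _ → 1# ≈ 1#)

  IsRingAut : (Carrier → Carrier) → Set (c ⊔ ℓ)
  IsRingAut σ =
      (∀ {x y} → x ≈ y → σ x ≈ σ y)
    × (∀ x y → σ (x + y) ≈ σ x + σ y)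
    × (∀ x y → σ (x * y) ≈ σ x * σ y)
    × (σ 1# ≈ 1#)
    × (∀ x y → σ x ≈ σ y → x ≈ y)
    × (∀ y → ∃ λ x → σ x ≈ y)

  -- σ is a generator of Gal(F_{q^n}/F_q): an automorphism fixing the
  -- subfield F_q = {x | x^q = x} pointwise and having order exactly n.
  IsGaloisGenerator : ℕ → ℕ → (Carrier → Carrier) → Set (c ⊔ ℓ)
  IsGaloisGenerator q n σ =
      IsRingAut σ
    × (∀ x → pow x q ≈ x → σ x ≈ x)
    × (∀ x → iter σ n x ≈ x)
    × (∀ m → 1 ≤ m → m < n → ∃ λ x → ¬ (iter σ m x ≈ x))

  normk : (Carrier → Carrier) → ℕ → Carrier → Carrier
  normk σ zero x = 1#
  normk σ (suc k) x = normk σ k x * iter σ k x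

  norm : (Carrier → Carrier) → ℕ → Carrier → Carrier
  norm σ n x = normk σ n x

  Lmap : (Carrier → Carrier) → Carrier → Carrier → Carrier → Carrier → Carrier
  Lmap σ a b c' x = a * x + b * σ x + c' * σ (σ x)

  -- H σ a b ci k  =  N_k(b/c) · G_k  with denominators cleared
  -- (N_k(x) = x^{1+σ+...+σ^{k-1}}, ci = c⁻¹).  Multiplying the recursion
  -- G_k = -G_{k-1} - u^{σ^{k-2}} G_{k-2}, u = a^σ c / b^{σ+1}, by N_k(b/c)
  -- gives H_0 = 1, H_1 = -(b/c),
  -- H_k = -(b/c)^{σ^{k-1}} H_{k-1} - (a/c)^{σ^{k-1}} H_{k-2}.
  H : (Carrier → Carrier) → Carrier → Carrier → Carrier → ℕ → Carrier
  H σ a b ci zero = 1#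
  H σ a b ci (suc zero) = - (b * ci)
  H σ a b ci (suc (suc k)) =
    - (iter σ (suc k) (b * ci) * H σ a b ci (suc k))
    - iter σ (suc k) (a * ci) * H σ a b ci k

  -- N(b/c) (G_n + G_n^σ + G_{n-1}^σ) with denominators cleared
  -- = H_n + σ(H_n) + (b/c) σ(H_{n-1})   (using σ^n = id).
  E : (Carrier → Carrier) → Carrier → Carrier → Carrier → ℕ → Carrier
  E σ a b ci n =
    H σ a b ci n + σ (H σ a b ci n) + (b * ci) * σ (H σ a b ci (ℕ.pred n))

{-# OPTIONS --safe #-}
module Submission where

-- With α = a/c and β = b/c, a root x satisfies σ²x = − β σx − α x, so (σᵏx , σᵏ⁺¹x) is obtained
-- from (x , σx) by a matrix A_k over F_{q^n} whose second column is (H_{k−1} , H_k). As σⁿ = 1, roots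
-- give vectors fixed by A = A_n. Conversely every fixed vector descends to roots by averaging over
-- the Galois group, where linear independence of characters produces a non-zero value, so the
-- roots form an F_q-space of the same dimension as ker (A − 1). Now D = det (A − 1), and A = 1
-- exactly when H_{n−1} = 0 and H_n = 1. That the fixed field of σ has exactly q elements is Artin's
-- theorem, obtained by peeling n factors of degree one off σⁿ − 1.

-- The second column of A_k suffices because A_{k+1} = σ(A_k) A_1: this relation writes the first
-- column through σ-conjugates of the second, and it explains the conjugates inside `E`, which is
-- the trace of A. The matrix acts linearly over F_{q^n}, while the roots form a space over F_q
-- only. No dimension theory is set up to bridge this; determinants do the work. `D` detects a
-- non-zero root, and `W x y` = x σy - y σx, the σ-analogue of a Wronskian, detects a second
-- independent one. The descent is therefore stated with a linear form (f , g) whose value must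
-- survive the averaging: (1 , 0) yields a non-zero root, (- σx₀ , x₀) a root independent of x₀. The
-- size of the fixed field stays an unknown k until kⁿ = qⁿ is reached: each further peeled factor
-- multiplies a kernel by k, and after n factors the kernel is the whole field.

open import Defs
open import Algebra.Bundles using (CommutativeRing; RawRing)
open import Algebra.Solver.Ring.AlmostCommutativeRing
  using (fromCommutativeRing; _-Raw-AlmostCommutative⟶_)
open import Data.Empty using (⊥-elim)
open import Data.Fin as Fin using (Fin)
import Data.Fin.Properties as Fin
open import Data.Integer as ℤ using (ℤ; -[1+_]) renaming (+_ to pos)
import Data.Integer.Properties as ℤ
open import Data.List as List using (List; []; _∷_; length; map; filter; cartesianProductWith)
import Data.List.Properties as List
open import Data.List.Membership.Propositional.Properties using (∈-lookup)
open import Data.List.Relation.Unary.All as All using (All; []; _∷_)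
import Data.List.Relation.Unary.All.Properties as All
open import Data.List.Relation.Unary.AllPairs using (AllPairs; []; _∷_)
import Data.List.Relation.Unary.AllPairs.Properties as AllPairs
open import Data.List.Relation.Unary.Any as Any using (Any; here; there)
import Data.List.Relation.Unary.Any.Properties as Any
open import Data.Maybe using (Maybe; just; nothing)
open import Data.Nat as ℕ using (ℕ; zero; suc; _≤_; _<_; _∸_; _^_; pred; s≤s)
open import Data.Nat.Primality using (prime⇒nonTrivial)
import Data.Nat.Properties as ℕ
open import Data.Product using (∃; ∃₂; _×_; _,_; proj₁; proj₂)
open import Data.Sum using (inj₁; inj₂)
open import Function using (_∘_)
open import Function.Bundles using (_⇔_; mk⇔)
open import Level using (_⊔_)
open import Relation.Binary.Definitions using (tri<; tri≈; tri>)
open import Relation.Binary.PropositionalEquality as ≡ using (_≡_)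
open import Relation.Nullary using (¬_; Dec; yes; no)
import Relation.Nullary.Decidable as Dec

-- Integer coefficients for the ring solver over an arbitrary commutative ring.

module IntegerCoefficients {c ℓ} (R : CommutativeRing c ℓ) where
  open CommutativeRing R
  open import Algebra.Properties.Ring ring
  open import Algebra.Properties.AbelianGroup +-abelianGroup using (⁻¹-∙-comm)
  open import Algebra.Properties.Semiring.Mult.TCOptimised semiring
    using (×-homo-+; ×1-homo-*; 1+×) renaming (_×_ to _·_)
  open import Relation.Binary.Reasoning.Setoid setoid

  private
    fromℤ : ℤ → Carrier
    fromℤ (pos n)  = n · 1#
    fromℤ -[1+ n ] = - (suc n · 1#)

    fromℤ-neg : ∀ i → fromℤ (ℤ.- i) ≈ - fromℤ i
    fromℤ-neg (pos zero)    = sym -0#≈0#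
    fromℤ-neg (pos (suc n)) = refl
    fromℤ-neg -[1+ n ]      = sym (-‿involutive _)

    fromℤ-⊖ : ∀ m n → fromℤ (m ℤ.⊖ n) ≈ m · 1# + - (n · 1#)
    fromℤ-⊖ zero    zero    = sym (trans (+-identityˡ _) -0#≈0#)
    fromℤ-⊖ zero    (suc n) = sym (+-identityˡ _)
    fromℤ-⊖ (suc m) zero    = sym (trans (+-congˡ -0#≈0#) (+-identityʳ _))
    fromℤ-⊖ (suc m) (suc n) = begin
      fromℤ (suc m ℤ.⊖ suc n)                  ≡⟨ ≡.cong fromℤ (ℤ.[1+m]⊖[1+n]≡m⊖n m n) ⟩
      fromℤ (m ℤ.⊖ n)                          ≈⟨ fromℤ-⊖ m n ⟩
      x + - y                                  ≈⟨ +-congʳ (+-identityʳ x) ⟨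
      (x + 0#) + - y                           ≈⟨ +-congʳ (+-congˡ (-‿inverseʳ 1#)) ⟨
      (x + (1# + - 1#)) + - y                  ≈⟨ +-congʳ (+-assoc x 1# (- 1#)) ⟨
      ((x + 1#) + - 1#) + - y                  ≈⟨ +-assoc _ _ _ ⟩
      (x + 1#) + (- 1# + - y)                  ≈⟨ +-cong (+-comm x 1#) (⁻¹-∙-comm 1# y) ⟩
      (1# + x) + - (1# + y)                    ≈⟨ +-cong (1+× m 1#) (-‿cong (1+× n 1#)) ⟨
      suc m · 1# + - (suc n · 1#)              ∎
      where
      x = m · 1#
      y = n · 1#

    fromℤ-+ : ∀ i j → fromℤ (i ℤ.+ j) ≈ fromℤ i + fromℤ j
    fromℤ-+ (pos m)  (pos n)  = ×-homo-+ 1# m n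
    fromℤ-+ (pos m)  -[1+ n ] = fromℤ-⊖ m (suc n)
    fromℤ-+ -[1+ m ] (pos n)  = trans (fromℤ-⊖ n (suc m)) (+-comm _ _)
    fromℤ-+ -[1+ m ] -[1+ n ] = begin
      - (suc (suc (m ℕ.+ n)) · 1#)        ≡⟨ ≡.cong (λ k → - (suc k · 1#)) (ℕ.+-suc m n) ⟨
      - ((suc m ℕ.+ suc n) · 1#)          ≈⟨ -‿cong (×-homo-+ 1# (suc m) (suc n)) ⟩
      - (suc m · 1# + suc n · 1#)         ≈⟨ ⁻¹-∙-comm _ _ ⟨
      - (suc m · 1#) + - (suc n · 1#)     ∎

    fromℤ-pos-* : ∀ m j → fromℤ (pos m ℤ.* j) ≈ m · 1# * fromℤ j
    fromℤ-pos-* m (pos n) = begin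
      fromℤ (pos m ℤ.* pos n)  ≡⟨ ≡.cong fromℤ (ℤ.pos-* m n) ⟨
      (m ℕ.* n) · 1#           ≈⟨ ×1-homo-* m n ⟩
      m · 1# * n · 1#          ∎
    fromℤ-pos-* m -[1+ n ] = begin
      fromℤ (pos m ℤ.* ℤ.- pos (suc n))   ≡⟨ ≡.cong fromℤ (ℤ.neg-distribʳ-* (pos m) (pos (suc n))) ⟨
      fromℤ (ℤ.- (pos m ℤ.* pos (suc n))) ≈⟨ fromℤ-neg (pos m ℤ.* pos (suc n)) ⟩
      - fromℤ (pos m ℤ.* pos (suc n))     ≈⟨ -‿cong (fromℤ-pos-* m (pos (suc n))) ⟩
      - (m · 1# * suc n · 1#)             ≈⟨ -‿distribʳ-* _ _ ⟩
      m · 1# * - (suc n · 1#)             ∎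

    fromℤ-* : ∀ i j → fromℤ (i ℤ.* j) ≈ fromℤ i * fromℤ j
    fromℤ-* (pos m)  j = fromℤ-pos-* m j
    fromℤ-* -[1+ m ] j = begin
      fromℤ (ℤ.- pos (suc m) ℤ.* j)     ≡⟨ ≡.cong fromℤ (ℤ.neg-distribˡ-* (pos (suc m)) j) ⟨
      fromℤ (ℤ.- (pos (suc m) ℤ.* j))   ≈⟨ fromℤ-neg (pos (suc m) ℤ.* j) ⟩
      - fromℤ (pos (suc m) ℤ.* j)       ≈⟨ -‿cong (fromℤ-pos-* (suc m) j) ⟩
      - (suc m · 1# * fromℤ j)          ≈⟨ -‿distribˡ-* _ _ ⟩
      - (suc m · 1#) * fromℤ j          ∎

    ℤ-rawRing : RawRing _ _
    ℤ-rawRing = CommutativeRing.rawRing ℤ.+-*-commutativeRing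

    homomorphism : ℤ-rawRing -Raw-AlmostCommutative⟶ fromCommutativeRing R
    homomorphism = record
      { ⟦_⟧    = fromℤ
      ; +-homo = fromℤ-+
      ; *-homo = fromℤ-*
      ; -‿homo = fromℤ-neg
      ; 0-homo = refl
      ; 1-homo = refl
      }

    -- In positive characteristic distinct integers can have equal images, so a failed comparison in
    -- ℤ decides nothing.
    weak-dec : ∀ i j → Maybe (fromℤ i ≈ fromℤ j)
    weak-dec i j with i ℤ.≟ j
    ... | yes ≡.refl = just refl
    ... | no _       = nothing

  open import Algebra.Solver.Ring ℤ-rawRing (fromCommutativeRing R) homomorphism weak-dec
    public using (solve; con; _:+_; _:*_; _:-_; :-_; _:=_)

-- Cardinalities of predicates up to setoid equality.

module Counting {c ℓ} (R : CommutativeRing c ℓ) where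
  open CommutativeRing R
  open Setup R

  private
    Distinct : List Carrier → Set (c ⊔ ℓ)
    Distinct = AllPairs (λ x y → ¬ (x ≈ y))

    lookup-injective : ∀ {xs} → Distinct xs → ∀ i j →
      List.lookup xs i ≈ List.lookup xs j → i ≡ j
    lookup-injective (d ∷ ds) Fin.zero    Fin.zero    eq = ≡.refl
    lookup-injective (d ∷ ds) Fin.zero    (Fin.suc j) eq = ⊥-elim (All.lookup d (∈-lookup j) eq)
    lookup-injective (d ∷ ds) (Fin.suc i) Fin.zero    eq = ⊥-elim (All.lookup d (∈-lookup i) (sym eq))
    lookup-injective (d ∷ ds) (Fin.suc i) (Fin.suc j) eq =
      ≡.cong Fin.suc (lookup-injective ds i j eq)

  -- Pigeonhole: an index of `xs` is sent to the position at which `cover` finds its entry in `ys`,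
  -- and the distinctness of `xs` makes this map injective.
  HasExactly-mono : ∀ {m n P Q} → HasExactly m P → HasExactly n Q →
    (∀ x → P x → Q x) → m ≤ n
  HasExactly-mono {P = P} (xs , ≡.refl , xs∈P , xs! , _) (ys , ≡.refl , _ , _ , cover) P⊆Q =
    Fin.injective⇒≤ {f = f} f-injective
    where
    at : ∀ i → Any (List.lookup xs i ≈_) ys
    at i = cover _ (P⊆Q _ (All.lookup xs∈P (∈-lookup i)))

    f : Fin (length xs) → Fin (length ys)
    f i = Any.index (at i)

    f-injective : ∀ {i j} → f i ≡ f j → i ≡ j
    f-injective {i} {j} eq = lookup-injective xs! i j (trans (Any.lookup-index (at i))
      (trans (reflexive (≡.cong (List.lookup ys) eq)) (sym (Any.lookup-index (at j)))))

  HasExactly-unique : ∀ {m n P Q} → HasExactly m P → HasExactly n Q →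
    (∀ x → P x → Q x) → (∀ x → Q x → P x) → m ≡ n
  HasExactly-unique p q P⊆Q Q⊆P =
    ℕ.≤-antisym (HasExactly-mono p q P⊆Q) (HasExactly-mono q p Q⊆P)

  -- Equality is decided by comparing positions in the enumeration. This is the source of every case
  -- distinction on field elements below.
  HasExactly-≈ : ∀ {m P} → HasExactly m P → ∀ {x y} → P x → P y → Dec (x ≈ y)
  HasExactly-≈ (xs , _ , _ , xs! , cover) {x} {y} px py =
    Dec.map′
      (λ eq → trans (Any.lookup-index i) (trans (reflexive (≡.cong (List.lookup xs) eq))
                (sym (Any.lookup-index j))))
      (λ eq → lookup-injective xs! _ _ (trans (sym (Any.lookup-index i))
                (trans eq (Any.lookup-index j))))
      (Any.index i Fin.≟ Any.index j)
    where
    i = cover x px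
    j = cover y py

  HasExactly-resp : ∀ {m P Q} → HasExactly m P →
    (∀ x → P x → Q x) → (∀ x → Q x → P x) → HasExactly m Q
  HasExactly-resp (xs , len , xs∈P , xs! , cover) P⊆Q Q⊆P =
    xs , len , All.map (P⊆Q _) xs∈P , xs! , λ x → cover x ∘ Q⊆P x

  HasExactly-singleton : ∀ y → HasExactly 1 (_≈ y)
  HasExactly-singleton y = (y ∷ []) , ≡.refl , (refl ∷ []) , ([] ∷ []) , λ x x≈y → here x≈y

  private
    length-cartesianProductWith : ∀ (f : Carrier → Carrier → Carrier) xs ys →
      length (cartesianProductWith f xs ys) ≡ length xs ℕ.* length ys
    length-cartesianProductWith f []       ys = ≡.refl
    length-cartesianProductWith f (x ∷ xs) ys = ≡.trans
      (List.length-++ (map (f x) ys))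
      (≡.cong₂ ℕ._+_ (List.length-map (f x) ys) (length-cartesianProductWith f xs ys))

    All-cartesianProductWith : ∀ {p q r} {P : Carrier → Set p} {Q : Carrier → Set q}
      {S : Carrier → Set r} {f} → (∀ {x y} → P x → Q y → S (f x y)) →
      ∀ {xs ys} → All P xs → All Q ys → All S (cartesianProductWith f xs ys)
    All-cartesianProductWith s []         qs = []
    All-cartesianProductWith s (px ∷ ps) qs =
      All.++⁺ (All.map⁺ (All.map (s px) qs)) (All-cartesianProductWith s ps qs)

  module _ {A B C : Carrier → Set ℓ} {f : Carrier → Carrier → Carrier}
    (f-cong : ∀ {x x′ y y′} → x ≈ x′ → y ≈ y′ → f x y ≈ f x′ y′)
    (f-into : ∀ {x y} → A x → B y → C (f x y))
    (f-injective : ∀ {x x′ y y′} → A x → A x′ → B y → B y′ →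
                   f x y ≈ f x′ y′ → x ≈ x′ × y ≈ y′)
    (f-onto : ∀ z → C z → ∃₂ λ x y → A x × B y × z ≈ f x y)
    where

    private
      distinct-row : ∀ {x ys} → A x → All B ys → Distinct ys → Distinct (map (f x) ys)
      distinct-row ax []         []         = []
      distinct-row ax (by ∷ bys) (y! ∷ ys!) =
        All.map⁺ (All.zipWith (λ (by′ , y≉) eq → y≉ (proj₂ (f-injective ax ax by by′ eq)))
                              (bys , y!))
        ∷ distinct-row ax bys ys!

      distinct-product : ∀ {xs ys} → All A xs → Distinct xs → All B ys → Distinct ys →
        Distinct (cartesianProductWith f xs ys)
      distinct-product []         []         bys ys! = []
      distinct-product {x ∷ xs} (ax ∷ axs) (x! ∷ xs!) bys ys! = AllPairs.++⁺
        (distinct-row ax bys ys!)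
        (distinct-product axs xs! bys ys!)
        (All.map⁺ (All.map (λ by → All-cartesianProductWith
            (λ (ax′ , x≉) by′ eq → x≉ (proj₁ (f-injective ax ax′ by by′ eq)))
            (All.zip (axs , x!)) bys)
          bys))

    -- The substitute for dimension counting: it turns a direct sum decomposition into a product of
    -- cardinalities.
    HasExactly-product : ∀ {m n} → HasExactly m A → HasExactly n B → HasExactly (m ℕ.* n) C
    HasExactly-product (xs , ≡.refl , axs , xs! , xcover) (ys , ≡.refl , bys , ys! , ycover) =
      cartesianProductWith f xs ys
      , length-cartesianProductWith f xs ys
      , All-cartesianProductWith f-into axs bys
      , distinct-product axs xs! bys ys!
      , λ z cz → let (x , y , ax , by , z≈) = f-onto z cz in
          Any.cartesianProductWith⁺ f (λ x≈ y≈ → trans z≈ (f-cong x≈ y≈))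
            (xcover x ax) (ycover y by)

  module _ {m} (all : HasExactly m (λ _ → 1# ≈ 1#)) where

    ∃? : ∀ {P : Carrier → Set ℓ} → (∀ x → Dec (P x)) → (∀ {x y} → x ≈ y → P x → P y) → Dec (∃ P)
    ∃? P? P-resp = Dec.map′ Any.satisfied
      (λ (x , px) → Any.map (λ x≈y → P-resp x≈y px) (proj₂ (proj₂ (proj₂ (proj₂ all))) x refl))
      (Any.any? P? (proj₁ all))

    HasExactly-dec : ∀ {P : Carrier → Set ℓ} → (∀ x → Dec (P x)) →
      (∀ {x y} → x ≈ y → P x → P y) → ∃ λ n → HasExactly n P
    HasExactly-dec {P} P? P-resp =
      let (xs , _ , _ , xs! , cover) = all in
      length (filter P? xs) , filter P? xs , ≡.refl , All.all-filter P? xs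
      , AllPairs.filter⁺ P? xs! , λ x px → filter-cover x px xs (cover x refl)
      where
      filter-cover : ∀ x → P x → ∀ xs → Any (x ≈_) xs → Any (x ≈_) (filter P? xs)
      filter-cover x px (y ∷ ys) x∈ with P? y | x∈
      ... | yes _  | here x≈y   = here x≈y
      ... | yes _  | there x∈ys = there (filter-cover x px ys x∈ys)
      ... | no ¬py | here x≈y   = ⊥-elim (¬py (P-resp x≈y px))
      ... | no _   | there x∈ys = filter-cover x px ys x∈ys

-- Finite sums.

module Sums {c ℓ} (R : CommutativeRing c ℓ) where
  open CommutativeRing R
  open IntegerCoefficients R

  sum : ℕ → (ℕ → Carrier) → Carrier
  sum zero    f = 0#
  sum (suc m) f = sum m f + f m

  sum-cong< : ∀ m {f g} → (∀ i → i < m → f i ≈ g i) → sum m f ≈ sum m g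
  sum-cong< zero    f≈g = refl
  sum-cong< (suc m) f≈g =
    +-cong (sum-cong< m (λ i i<m → f≈g i (ℕ.m<n⇒m<1+n i<m))) (f≈g m ℕ.≤-refl)

  sum-cong : ∀ m {f g} → (∀ i → f i ≈ g i) → sum m f ≈ sum m g
  sum-cong m f≈g = sum-cong< m (λ i _ → f≈g i)

  sum-0 : ∀ m {f} → (∀ i → f i ≈ 0#) → sum m f ≈ 0#
  sum-0 zero    f≈0 = refl
  sum-0 (suc m) f≈0 = trans (+-cong (sum-0 m f≈0) (f≈0 m)) (+-identityˡ 0#)

  sum-+ : ∀ m f g → sum m (λ i → f i + g i) ≈ sum m f + sum m g
  sum-+ zero    f g = sym (+-identityˡ 0#)
  sum-+ (suc m) f g = trans (+-congʳ (sum-+ m f g))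
    (solve 4 (λ s t x y → s :+ t :+ (x :+ y) := s :+ x :+ (t :+ y)) refl _ _ _ _)

  sum-*ˡ : ∀ m x f → sum m (λ i → x * f i) ≈ x * sum m f
  sum-*ˡ zero    x f = sym (zeroʳ x)
  sum-*ˡ (suc m) x f = trans (+-congʳ (sum-*ˡ m x f)) (sym (distribˡ x _ _))

  sum-linear : ∀ m x f g → sum m (λ i → f i + x * g i) ≈ sum m f + x * sum m g
  sum-linear m x f g = trans (sum-+ m f _) (+-congˡ (sum-*ˡ m x g))

  sum-head : ∀ m f → sum (suc m) f ≈ f 0 + sum m (f ∘ suc)
  sum-head zero    f = +-comm 0# (f 0)
  sum-head (suc m) f = trans (+-congʳ (sum-head m f)) (+-assoc _ _ _)

  -- Both sides are the sum of `f` over 0, ..., m with one end removed, and the two ends agree.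
  sum-rotate : ∀ m f → f m ≈ f 0 → sum m (f ∘ suc) ≈ sum m f
  sum-rotate m f fm≈f0 = begin
    sum m (f ∘ suc)               ≈⟨ solve 2 (λ s x → s := (x :+ s) :- x) refl _ (f 0) ⟩
    (f 0 + sum m (f ∘ suc)) - f 0 ≈⟨ +-cong (sum-head m f) (-‿cong fm≈f0) ⟨
    (sum m f + f m) - f m         ≈⟨ solve 2 (λ s x → s :+ x :- x := s) refl _ _ ⟩
    sum m f                       ∎
    where open import Relation.Binary.Reasoning.Setoid setoid

-- Automorphisms and the twisted polynomials in them.

module Automorphism {c ℓ} (R : CommutativeRing c ℓ)
  (φ : CommutativeRing.Carrier R → CommutativeRing.Carrier R)
  (aut : Setup.IsRingAut R φ) where
  open CommutativeRing R
  open import Algebra.Properties.Ring ring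
  open import Relation.Binary.Reasoning.Setoid setoid
  open Setup R
  open Sums R
  open IntegerCoefficients R

  φ-cong : ∀ {x y} → x ≈ y → φ x ≈ φ y
  φ-cong = proj₁ aut

  φ-+ : ∀ x y → φ (x + y) ≈ φ x + φ y
  φ-+ = proj₁ (proj₂ aut)

  φ-* : ∀ x y → φ (x * y) ≈ φ x * φ y
  φ-* = proj₁ (proj₂ (proj₂ aut))

  φ-1 : φ 1# ≈ 1#
  φ-1 = proj₁ (proj₂ (proj₂ (proj₂ aut)))

  φ-injective : ∀ {x y} → φ x ≈ φ y → x ≈ y
  φ-injective = proj₁ (proj₂ (proj₂ (proj₂ (proj₂ aut)))) _ _

  φ-surjective : ∀ y → ∃ λ x → φ x ≈ y
  φ-surjective = proj₂ (proj₂ (proj₂ (proj₂ (proj₂ aut))))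

  φ-0 : φ 0# ≈ 0#
  φ-0 = +-cancelˡ (φ 0#) _ _ (begin
    φ 0# + φ 0#  ≈⟨ φ-+ 0# 0# ⟨
    φ (0# + 0#)  ≈⟨ φ-cong (+-identityˡ 0#) ⟩
    φ 0#         ≈⟨ +-identityʳ _ ⟨
    φ 0# + 0#    ∎)

  φ-neg : ∀ x → φ (- x) ≈ - φ x
  φ-neg x = +-cancelˡ (φ x) _ _ (begin
    φ x + φ (- x)  ≈⟨ φ-+ x (- x) ⟨
    φ (x - x)      ≈⟨ φ-cong (-‿inverseʳ x) ⟩
    φ 0#           ≈⟨ φ-0 ⟩
    0#             ≈⟨ -‿inverseʳ _ ⟨
    φ x - φ x      ∎)

  φ-sub : ∀ x y → φ (x - y) ≈ φ x - φ y
  φ-sub x y = trans (φ-+ x (- y)) (+-congˡ (φ-neg y))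

  φ-sum : ∀ m f → φ (sum m f) ≈ sum m (φ ∘ f)
  φ-sum zero    f = φ-0
  φ-sum (suc m) f = trans (φ-+ _ _) (+-congʳ (φ-sum m f))

  iter-cong : ∀ m {x y} → x ≈ y → iter φ m x ≈ iter φ m y
  iter-cong zero    x≈y = x≈y
  iter-cong (suc m) x≈y = φ-cong (iter-cong m x≈y)

  iter-+ : ∀ m x y → iter φ m (x + y) ≈ iter φ m x + iter φ m y
  iter-+ zero    x y = refl
  iter-+ (suc m) x y = trans (φ-cong (iter-+ m x y)) (φ-+ _ _)

  iter-* : ∀ m x y → iter φ m (x * y) ≈ iter φ m x * iter φ m y
  iter-* zero    x y = refl
  iter-* (suc m) x y = trans (φ-cong (iter-* m x y)) (φ-* _ _)

  iter-1 : ∀ m → iter φ m 1# ≈ 1#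
  iter-1 zero    = refl
  iter-1 (suc m) = trans (φ-cong (iter-1 m)) φ-1

  iter-0 : ∀ m → iter φ m 0# ≈ 0#
  iter-0 zero    = refl
  iter-0 (suc m) = trans (φ-cong (iter-0 m)) φ-0

  iter-sub : ∀ m x y → iter φ m (x - y) ≈ iter φ m x - iter φ m y
  iter-sub zero    x y = refl
  iter-sub (suc m) x y = trans (φ-cong (iter-sub m x y)) (φ-sub _ _)

  iter-injective : ∀ m {x y} → iter φ m x ≈ iter φ m y → x ≈ y
  iter-injective zero    eq = eq
  iter-injective (suc m) eq = iter-injective m (φ-injective eq)

  iter-fixed : ∀ m {x} → φ x ≈ x → iter φ m x ≈ x
  iter-fixed zero    eq = refl
  iter-fixed (suc m) eq = trans (φ-cong (iter-fixed m eq)) eq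

  iter-φ : ∀ m x → iter φ m (φ x) ≡ iter φ (suc m) x
  iter-φ zero    x = ≡.refl
  iter-φ (suc m) x = ≡.cong φ (iter-φ m x)

  iter-iter : ∀ l m x → iter φ l (iter φ m x) ≡ iter φ (l ℕ.+ m) x
  iter-iter zero    m x = ≡.refl
  iter-iter (suc l) m x = ≡.cong φ (iter-iter l m x)

  -- A twisted polynomial in φ acting on `x`. The index `m` counts coefficients, so the degree is
  -- below `m`; hence the `suc` wherever a degree is prescribed.
  operator : ℕ → (ℕ → Carrier) → Carrier → Carrier
  operator m a x = sum m (λ i → a i * iter φ i x)

  operator-cong : ∀ m a {x y} → x ≈ y → operator m a x ≈ operator m a y
  operator-cong m a x≈y = sum-cong m (λ i → *-congˡ (iter-cong i x≈y))

  operator-linear : ∀ m a {μ} → φ μ ≈ μ → ∀ x y →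
    operator m a (x + μ * y) ≈ operator m a x + μ * operator m a y
  operator-linear m a {μ} φμ≈μ x y = trans (sum-cong m term) (sum-linear m μ _ _)
    where
    term : ∀ i → a i * iter φ i (x + μ * y) ≈ a i * iter φ i x + μ * (a i * iter φ i y)
    term i = begin
      a i * iter φ i (x + μ * y)
        ≈⟨ *-congˡ (trans (iter-+ i _ _) (+-congˡ (trans (iter-* i _ _) (*-congʳ (iter-fixed i φμ≈μ))))) ⟩
      a i * (iter φ i x + μ * iter φ i y)
        ≈⟨ solve 4 (λ a u μ v → a :* (u :+ μ :* v) := a :* u :+ μ :* (a :* v)) refl _ _ _ _ ⟩
      a i * iter φ i x + μ * (a i * iter φ i y) ∎

  -- Abel summation: an operator annihilating 1 factors through φ − 1.
  private
    abel : ∀ m a y →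
      operator m (λ i → - sum (suc i) a) (φ y - y) + sum m a * iter φ m y ≈ operator m a y
    abel zero    a y = trans (+-congˡ (zeroˡ y)) (+-identityˡ 0#)
    abel (suc m) a y = begin
      operator m d (φ y - y) + d m * iter φ m (φ y - y) + (S + a m) * v
        ≈⟨ +-congʳ (+-congˡ (*-congˡ (trans (iter-sub m _ _) (+-congʳ (reflexive (iter-φ m y)))))) ⟩
      operator m d (φ y - y) + - (S + a m) * (v - u) + (S + a m) * v
        ≈⟨ solve 5 (λ t s a u v →
             t :+ (:- (s :+ a)) :* (v :- u) :+ (s :+ a) :* v := (t :+ s :* u) :+ a :* u)
             refl _ S (a m) u v ⟩
      (operator m d (φ y - y) + S * u) + a m * u
        ≈⟨ +-congʳ (abel m a y) ⟩
      operator m a y + a m * u ∎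
      where
      d = λ i → - sum (suc i) a
      S = sum m a
      u = iter φ m y
      v = iter φ (suc m) y

  operator-factor : ∀ m a y → sum (suc m) a ≈ 0# →
    operator (suc m) a y ≈ operator m (λ i → - sum (suc i) a) (φ y - y)
  operator-factor m a y Σa≈0 = begin
    operator (suc m) a y
      ≈⟨ abel (suc m) a y ⟨
    -- The total of the coefficients occurs twice, as the top coefficient of the quotient and as the
    -- remainder. Its vanishing therefore also lowers the length to `m`.
    (operator m d (φ y - y) + - sum (suc m) a * t) + sum (suc m) a * s
      ≈⟨ +-cong (+-congˡ (*-congʳ (-‿cong Σa≈0))) (*-congʳ Σa≈0) ⟩
    (operator m d (φ y - y) + - 0# * t) + 0# * s
      ≈⟨ solve 3 (λ x t s → (x :+ (:- con (pos 0)) :* t) :+ con (pos 0) :* s := x) refl _ t s ⟩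
    operator m d (φ y - y) ∎
    where
    d = λ i → - sum (suc i) a
    t = iter φ m (φ y - y)
    s = iter φ (suc m) y

-- Finite fields and independence of characters.

module FiniteField {c ℓ} (R : CommutativeRing c ℓ) {N : ℕ}
  (finite : Setup.IsFiniteFieldOfSize R N) where
  open CommutativeRing R
  open import Algebra.Properties.Ring ring
  open import Relation.Binary.Reasoning.Setoid setoid
  open Setup R
  open Sums R
  open IntegerCoefficients R
  open Counting R

  1≉0 : ¬ (1# ≈ 0#)
  1≉0 = proj₁ (proj₁ finite)

  inverse : ∀ x → ¬ (x ≈ 0#) → ∃ λ y → x * y ≈ 1#
  inverse = proj₂ (proj₁ finite)

  all-elements : HasExactly N (λ _ → 1# ≈ 1#)
  all-elements = proj₂ finite

  infix 4 _≈?_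
  _≈?_ : ∀ x y → Dec (x ≈ y)
  x ≈? y = HasExactly-≈ all-elements {x} {y} refl refl

  *-cancelˡ-nonzero : ∀ {x y z} → ¬ (x ≈ 0#) → x * y ≈ x * z → y ≈ z
  *-cancelˡ-nonzero {x} {y} {z} x≉0 xy≈xz = begin
    y            ≈⟨ *-identityˡ y ⟨
    1# * y       ≈⟨ *-congʳ (trans (*-comm w x) xw≈1) ⟨
    w * x * y    ≈⟨ *-assoc w x y ⟩
    w * (x * y)  ≈⟨ *-congˡ xy≈xz ⟩
    w * (x * z)  ≈⟨ *-assoc w x z ⟨
    w * x * z    ≈⟨ *-congʳ (trans (*-comm w x) xw≈1) ⟩
    1# * z       ≈⟨ *-identityˡ z ⟩
    z            ∎
    where
    w = proj₁ (inverse x x≉0)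
    xw≈1 = proj₂ (inverse x x≉0)

  *-nonzero : ∀ {x y} → ¬ (x ≈ 0#) → ¬ (y ≈ 0#) → ¬ (x * y ≈ 0#)
  *-nonzero {x} x≉0 y≉0 xy≈0 = y≉0 (*-cancelˡ-nonzero x≉0 (trans xy≈0 (sym (zeroʳ x))))

  *-zero-cancelʳ : ∀ {x y} → ¬ (y ≈ 0#) → x * y ≈ 0# → x ≈ 0#
  *-zero-cancelʳ {x} {y} y≉0 xy≈0 =
    *-cancelˡ-nonzero y≉0 (trans (*-comm y x) (trans xy≈0 (sym (zeroʳ y))))

  x-y≉0 : ∀ {x y} → ¬ (x ≈ y) → ¬ (x - y ≈ 0#)
  x-y≉0 x≉y = x≉y ∘ x∙y⁻¹≈ε⇒x≈y _ _

  module Characters (φ : Carrier → Carrier) (aut : IsRingAut φ) (n : ℕ)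
    (moves : ∀ m → 1 ≤ m → m < n → ∃ λ x → ¬ (iter φ m x ≈ x)) where
    open Automorphism R φ aut

    separates : ∀ {i m} → i < m → m < n → ∃ λ y → ¬ (iter φ i y ≈ iter φ m y)
    separates {i} {m} i<m m<n =
      let (y , y≉) = moves (m ∸ i) (ℕ.m<n⇒0<n∸m i<m) (ℕ.≤-<-trans (ℕ.m∸n≤m m i) m<n) in
      y , λ eq → y≉ (iter-injective i (begin
        iter φ i (iter φ (m ∸ i) y)  ≡⟨ iter-iter i (m ∸ i) y ⟩
        iter φ (i ℕ.+ (m ∸ i)) y     ≡⟨ ≡.cong (λ l → iter φ l y) (ℕ.m+[n∸m]≡n (ℕ.<⇒≤ i<m)) ⟩
        iter φ m y                   ≈⟨ eq ⟨
        iter φ i y                   ∎))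

    -- Dedekind's argument, by induction on the length of the relation. Once the lower coefficients
    -- are known to vanish, evaluation at 1 leaves only the top one.
    independence : ∀ m → m ≤ n → ∀ a → (∀ x → operator m a x ≈ 0#) →
      ∀ i → i < m → a i ≈ 0#
    independence (suc m) m<n a vanishes = coefficient
      where
      -- Substituting y x and subtracting φᵐ y times the relation removes the last term.
      shorter : ∀ y x → operator m (λ i → a i * (iter φ i y - iter φ m y)) x ≈ 0#
      shorter y x = begin
        operator m (λ i → a i * (iter φ i y - iter φ m y)) x
          ≈⟨ sum-cong m term ⟩
        sum m h
          ≈⟨ +-identityʳ _ ⟨
        sum m h + 0#
          ≈⟨ +-congˡ (trans (sym (term m)) (solve 3 (λ a u v → a :* (u :- u) :* v := con (pos 0)) refl (a m) _ _)) ⟨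
        sum (suc m) h
          ≈⟨ sum-linear (suc m) (- iter φ m y) _ _ ⟩
        operator (suc m) a (y * x) + - iter φ m y * operator (suc m) a x
          ≈⟨ +-cong (vanishes (y * x)) (trans (*-congˡ (vanishes x)) (zeroʳ _)) ⟩
        0# + 0#
          ≈⟨ +-identityˡ 0# ⟩
        0# ∎
        where
        h : ℕ → Carrier
        h i = a i * iter φ i (y * x) + - iter φ m y * (a i * iter φ i x)

        term : ∀ i → a i * (iter φ i y - iter φ m y) * iter φ i x ≈ h i
        term i = begin
          a i * (iter φ i y - iter φ m y) * iter φ i x
            ≈⟨ solve 4 (λ a u v x → a :* (u :- v) :* x := a :* (u :* x) :+ (:- v) :* (a :* x))
                 refl (a i) (iter φ i y) (iter φ m y) (iter φ i x) ⟩
          a i * (iter φ i y * iter φ i x) + - iter φ m y * (a i * iter φ i x)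
            ≈⟨ +-congʳ (*-congˡ (iter-* i y x)) ⟨
          h i ∎

      lower : ∀ i → i < m → a i ≈ 0#
      lower i i<m =
        -- The choice of `y` may depend on `i`: in the shorter relation only the factor at `i` has
        -- to be non-zero.
        let (y , y≉) = separates i<m m<n in
        *-zero-cancelʳ (x-y≉0 y≉) (independence m (ℕ.<⇒≤ m<n) _ (shorter y) i i<m)

      top : a m ≈ 0#
      top = begin
        a m                               ≈⟨ *-identityʳ _ ⟨
        a m * 1#                          ≈⟨ *-congˡ (iter-1 m) ⟨
        a m * iter φ m 1#                 ≈⟨ +-identityˡ _ ⟨
        0# + a m * iter φ m 1#            ≈⟨ +-congʳ (sum-0 m (λ _ → zeroˡ 1#)) ⟨
        sum m (λ _ → 0# * 1#) + a m * iter φ m 1#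
          ≈⟨ +-congʳ (sum-cong< m (λ i i<m → *-cong (lower i i<m) (iter-1 i))) ⟨
        operator (suc m) a 1#             ≈⟨ vanishes 1# ⟩
        0#                                ∎

      coefficient : ∀ i → i < suc m → a i ≈ 0#
      coefficient i (s≤s i≤m) with ℕ.m≤n⇒m<n∨m≡n i≤m
      ... | inj₁ i<m    = lower i i<m
      ... | inj₂ ≡.refl = top

    -- The contrapositive of `independence` with an actual witness, found by searching the finite
    -- field.
    nonvanishing : ∀ m → m ≤ n → ∀ a i → i < m → ¬ (a i ≈ 0#) →
      ∃ λ x → ¬ (operator m a x ≈ 0#)
    nonvanishing m m≤n a i i<m aᵢ≉0
      with ∃? all-elements (λ x → Dec.¬? (operator m a x ≈? 0#))
             (λ x≈y px py → px (trans (operator-cong m a x≈y) py))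
    ... | yes found = found
    ... | no none   = ⊥-elim (aᵢ≉0 (independence m m≤n a
            (λ x → Dec.decidable-stable (operator m a x ≈? 0#) (λ px → none (x , px))) i i<m))

-- The size of the fixed field.

^-cancelʳ-≡ : ∀ n k q → 1 ≤ n → k ^ n ≡ q ^ n → k ≡ q
^-cancelʳ-≡ n@(suc _) k q _ eq with ℕ.<-cmp k q
... | tri< k<q _ _ = ⊥-elim (ℕ.<-irrefl eq (ℕ.^-monoˡ-< n k<q))
... | tri≈ _ k≡q _ = k≡q
... | tri> _ _ q<k = ⊥-elim (ℕ.<-irrefl (≡.sym eq) (ℕ.^-monoˡ-< n q<k))

module FixedField {c ℓ} (R : CommutativeRing c ℓ) (q n : ℕ) (2≤n : 2 ≤ n)
  (finite : Setup.IsFiniteFieldOfSize R (q ^ n))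
  (σ : CommutativeRing.Carrier R → CommutativeRing.Carrier R)
  (galois : Setup.IsGaloisGenerator R q n σ) where
  open CommutativeRing R
  open import Algebra.Properties.Ring ring
  open import Relation.Binary.Reasoning.Setoid setoid
  open Setup R
  open Sums R
  open IntegerCoefficients R
  open Counting R
  open FiniteField R finite

  σ-aut : IsRingAut σ
  σ-aut = proj₁ galois

  σⁿ : ∀ x → iter σ n x ≈ x
  σⁿ = proj₁ (proj₂ (proj₂ galois))

  σ-moves : ∀ m → 1 ≤ m → m < n → ∃ λ x → ¬ (iter σ m x ≈ x)
  σ-moves = proj₂ (proj₂ (proj₂ galois))

  open Automorphism R σ σ-aut
  open Characters σ σ-aut n σ-moves

  private
    fixed-finite : ∃ λ k → HasExactly k (λ x → σ x ≈ x)
    fixed-finite = HasExactly-dec all-elements (λ x → σ x ≈? x)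
      (λ x≈y σx≈x → trans (φ-cong (sym x≈y)) (trans σx≈x x≈y))

    k : ℕ
    k = proj₁ fixed-finite

    -- A factorisation of σⁿ − 1 (up to a scalar) into the operators of degrees r and j with
    -- coefficients s and p.
    record Factorisation (j r : ℕ) : Set (c ⊔ ℓ) where
      field
        p s         : ℕ → Carrier
        p-lead      : ¬ (p j ≈ 0#)
        p-degree    : ∀ i → j < i → p i ≈ 0#
        s-lead      : ¬ (s r ≈ 0#)
        annihilates : ∀ x → operator (suc r) s (operator (suc j) p x) ≈ 0#
        kernel      : HasExactly (k ^ j) (λ x → operator (suc j) p x ≈ 0#)

    open Factorisation

    -- σⁿ − 1 = (1 + σ + ⋯ + σⁿ⁻¹)(σ − 1)
    first : ∀ {m} → suc m ≡ n → Factorisation 1 m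
    first {m} ≡.refl = record
      { p = p₁ ; s = λ _ → 1#
      ; p-lead = 1≉0 ; p-degree = λ { (suc (suc _)) _ → refl ; (suc zero) (s≤s ()) }
      ; s-lead = 1≉0
      ; annihilates = λ x → begin
          operator (suc m) (λ _ → 1#) (operator 2 p₁ x)
            ≈⟨ operator-cong (suc m) _ (p₁-value x) ⟩
          operator (suc m) (λ _ → 1#) (σ x - x)
            ≈⟨ trace (suc m) x ⟩
          iter σ (suc m) x - x
            ≈⟨ +-congʳ (σⁿ x) ⟩
          x - x
            ≈⟨ -‿inverseʳ x ⟩
          0# ∎
      ; kernel = ≡.subst (λ l → HasExactly l (λ x → operator 2 p₁ x ≈ 0#)) (≡.sym (ℕ.^-identityʳ k))
          (HasExactly-resp (proj₂ fixed-finite)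
            (λ x σx≈x → trans (p₁-value x) (trans (+-congʳ σx≈x) (-‿inverseʳ x)))
            (λ x eq → x∙y⁻¹≈ε⇒x≈y _ _ (trans (sym (p₁-value x)) eq)))
      }
      where
      p₁ : ℕ → Carrier
      p₁ 0             = - 1#
      p₁ 1             = 1#
      -- The zero tail is needed: `extend` reads the coefficient one place beyond the leading one.
      p₁ (suc (suc _)) = 0#

      p₁-value : ∀ x → operator 2 p₁ x ≈ σ x - x
      p₁-value x = solve 2 (λ x y →
        con (pos 0) :+ (:- con (pos 1)) :* x :+ con (pos 1) :* y := y :- x) refl x (σ x)

      trace : ∀ l x → operator l (λ _ → 1#) (σ x - x) ≈ iter σ l x - x
      trace zero    x = sym (-‿inverseʳ x)
      trace (suc l) x = begin
        operator l (λ _ → 1#) (σ x - x) + 1# * iter σ l (σ x - x)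
          ≈⟨ +-cong (trace l x) (*-congˡ (trans (iter-sub l _ _) (+-congʳ (reflexive (iter-φ l x))))) ⟩
        (iter σ l x - x) + 1# * (iter σ (suc l) x - iter σ l x)
          ≈⟨ solve 3 (λ u x v → (u :- x) :+ con (pos 1) :* (v :- u) := v :- x) refl _ _ _ ⟩
        iter σ (suc l) x - x ∎

    -- Let P and S be the right and left factors. As P has degree j < n, some `e` has z = P e ≠ 0.
    -- The new right factor is (σ - 1) z⁻¹ P: it kills y exactly when P y / z is fixed by σ, so its
    -- kernel is that of P plus the fixed multiples of `e`, which is k times larger. Conversely S
    -- kills z, so S z kills 1 and is divisible on the right by σ - 1; the quotient is the new left
    -- factor.
    extend : ∀ {j r} → j < n → Factorisation j (suc r) → Factorisation (suc j) r
    extend {j} {r} j<n F = record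
      { p = p′ ; s = s′
      ; p-lead = λ eq → *-nonzero (σ-nonzero w≉0) (σ-nonzero (p-lead F)) (begin
          σ w * σ (p F j)                     ≈⟨ φ-* w _ ⟨
          σ (w * p F j)                       ≈⟨ solve 2 (λ x y → x := (x :- y :* con (pos 0))) refl _ w ⟩
          σ (w * p F j) - w * 0#              ≈⟨ +-congˡ (-‿cong (*-congˡ (p-degree F (suc j) ℕ.≤-refl))) ⟨
          p′ (suc j)                          ≈⟨ eq ⟩
          0#                                  ∎)
      ; p-degree = λ { (suc i) (s≤s j<i) → begin
          σ (w * p F i) - w * p F (suc i)
            ≈⟨ +-cong (φ-cong (*-congˡ (p-degree F i j<i)))
                      (-‿cong (*-congˡ (p-degree F (suc i) (ℕ.m<n⇒m<1+n j<i)))) ⟩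
          σ (w * 0#) - w * 0#
            ≈⟨ +-cong (trans (φ-cong (zeroʳ w)) φ-0) (-‿cong (zeroʳ w)) ⟩
          0# - 0#
            ≈⟨ -‿inverseʳ 0# ⟩
          0# ∎ }
      -- Since the coefficients `t` sum to zero, `s′ r` equals `t (suc r)`, a product of two
      -- non-zero factors.
      ; s-lead = λ eq → *-nonzero (s-lead F) (iter-nonzero (suc r) z≉0) (begin
          t (suc r)
            ≈⟨ solve 2 (λ x y → x := (y :+ x) :+ :- y) refl (t (suc r)) (sum (suc r) t) ⟩
          sum (suc (suc r)) t + s′ r
            ≈⟨ +-cong Σt≈0 eq ⟩
          0# + 0#
            ≈⟨ +-identityˡ 0# ⟩
          0# ∎)
      ; annihilates = λ x → begin
          operator (suc r) s′ (P′ x)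
            ≈⟨ operator-cong (suc r) s′ (P′-value x) ⟩
          operator (suc r) s′ (σ (w * P x) - w * P x)
            ≈⟨ operator-factor (suc r) t (w * P x) Σt≈0 ⟨
          operator (suc (suc r)) t (w * P x)
            ≈⟨ sum-cong (suc (suc r)) (λ i → trans (*-assoc _ _ _) (*-congˡ (sym (iter-* i _ _)))) ⟩
          operator (suc (suc r)) (s F) (z * (w * P x))
            ≈⟨ operator-cong (suc (suc r)) (s F) (z*w* (P x)) ⟩
          operator (suc (suc r)) (s F) (P x)
            ≈⟨ annihilates F x ⟩
          0# ∎
      ; kernel = ≡.subst (λ l → HasExactly l (λ x → P′ x ≈ 0#)) (ℕ.*-comm (k ^ j) k)
          (HasExactly-product {f = λ x μ → x + μ * e}
            (λ x≈ μ≈ → +-cong x≈ (*-congʳ μ≈))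
            into injective onto (kernel F) (proj₂ fixed-finite))
      }
      where
      P : Carrier → Carrier
      P = operator (suc j) (p F)

      outside : ∃ λ e → ¬ (P e ≈ 0#)
      outside = nonvanishing (suc j) j<n (p F) j ℕ.≤-refl (p-lead F)

      e = proj₁ outside
      z = P e
      z≉0 = proj₂ outside
      w = proj₁ (inverse z z≉0)

      zw≈1 : z * w ≈ 1#
      zw≈1 = proj₂ (inverse z z≉0)

      w≉0 : ¬ (w ≈ 0#)
      w≉0 w≈0 = 1≉0 (trans (sym zw≈1) (trans (*-congˡ w≈0) (zeroʳ z)))

      z*w* : ∀ x → z * (w * x) ≈ x
      z*w* x = trans (sym (*-assoc z w x)) (trans (*-congʳ zw≈1) (*-identityˡ x))

      iter-nonzero : ∀ m {x} → ¬ (x ≈ 0#) → ¬ (iter σ m x ≈ 0#)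
      iter-nonzero m x≉0 eq = x≉0 (iter-injective m (trans eq (sym (iter-0 m))))

      σ-nonzero : ∀ {x} → ¬ (x ≈ 0#) → ¬ (σ x ≈ 0#)
      σ-nonzero = iter-nonzero 1

      p′ : ℕ → Carrier
      p′ zero    = - (w * p F 0)
      p′ (suc i) = σ (w * p F i) - w * p F (suc i)

      t : ℕ → Carrier
      t i = s F i * iter σ i z

      -- By unfolding, this sum is the left factor of `F` applied to P e.
      Σt≈0 : sum (suc (suc r)) t ≈ 0#
      Σt≈0 = annihilates F e

      s′ : ℕ → Carrier
      s′ i = - sum (suc i) t

      P′ : Carrier → Carrier
      P′ = operator (suc (suc j)) p′

      P′-value : ∀ x → P′ x ≈ σ (w * P x) - w * P x
      P′-value x = begin
        operator (suc (suc j)) p′ x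
          ≈⟨ sum-head (suc j) _ ⟩
        - (w * p F 0) * x + sum (suc j) (λ i → p′ (suc i) * iter σ (suc i) x)
          ≈⟨ +-congˡ (sum-cong (suc j) term) ⟩
        - (w * p F 0) * x + sum (suc j) (λ i → f i + - w * g (suc i))
          ≈⟨ +-congˡ (sum-linear (suc j) (- w) f (g ∘ suc)) ⟩
        - (w * p F 0) * x + (sum (suc j) f + - w * sum (suc j) (g ∘ suc))
          ≈⟨ solve 5 (λ w a x s t →
               :- (w :* a) :* x :+ (s :+ (:- w) :* t) := s :- w :* (a :* x :+ t))
               refl w (p F 0) x _ _ ⟩
        sum (suc j) f - w * (g 0 + sum (suc j) (g ∘ suc))
          ≈⟨ +-congˡ (-‿cong (*-congˡ (sum-head (suc j) g))) ⟨
        sum (suc j) f - w * sum (suc (suc j)) g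
          ≈⟨ +-cong leading (-‿cong (*-congˡ (trans (+-congˡ
               (trans (*-congʳ (p-degree F (suc j) ℕ.≤-refl)) (zeroˡ _))) (+-identityʳ _)))) ⟩
        σ (w * P x) - w * P x ∎
        where
        f g : ℕ → Carrier
        f i = σ (w * (p F i * iter σ i x))
        g i = p F i * iter σ i x

        leading : sum (suc j) f ≈ σ (w * P x)
        leading = trans (sym (φ-sum (suc j) _)) (φ-cong (sum-*ˡ (suc j) w g))

        term : ∀ i → p′ (suc i) * iter σ (suc i) x ≈ f i + - w * g (suc i)
        term i = begin
          (σ (w * p F i) - w * p F (suc i)) * y
            ≈⟨ solve 4 (λ a w b y → (a :- w :* b) :* y := a :* y :+ (:- w) :* (b :* y)) refl _ _ _ _ ⟩
          σ (w * p F i) * y + - w * g (suc i)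
            ≈⟨ +-congʳ (φ-* _ _) ⟨
          σ (w * p F i * iter σ i x) + - w * g (suc i)
            ≈⟨ +-congʳ (φ-cong (*-assoc _ _ _)) ⟩
          f i + - w * g (suc i) ∎
          where y = iter σ (suc i) x

      value : ∀ {x μ} → P x ≈ 0# → σ μ ≈ μ → P (x + μ * e) ≈ μ * z
      value Px≈0 σμ≈μ = trans (operator-linear (suc j) (p F) σμ≈μ _ e)
        (trans (+-congʳ Px≈0) (+-identityˡ _))

      into : ∀ {x μ} → P x ≈ 0# → σ μ ≈ μ → P′ (x + μ * e) ≈ 0#
      into {x} {μ} Px≈0 σμ≈μ = begin
        P′ (x + μ * e)                  ≈⟨ P′-value _ ⟩
        σ (w * P (x + μ * e)) - w * P (x + μ * e)
          ≈⟨ +-cong (φ-cong wP≈μ) (-‿cong wP≈μ) ⟩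
        σ μ - μ                         ≈⟨ +-congʳ σμ≈μ ⟩
        μ - μ                           ≈⟨ -‿inverseʳ μ ⟩
        0#                              ∎
        where
        wP≈μ : w * P (x + μ * e) ≈ μ
        wP≈μ = trans (*-congˡ (value Px≈0 σμ≈μ))
          (trans (solve 3 (λ w μ z → w :* (μ :* z) := z :* (w :* μ)) refl w μ z) (z*w* μ))

      injective : ∀ {x x′ μ μ′} → P x ≈ 0# → P x′ ≈ 0# → σ μ ≈ μ → σ μ′ ≈ μ′ →
        x + μ * e ≈ x′ + μ′ * e → x ≈ x′ × μ ≈ μ′
      injective {x} {x′} {μ} {μ′} Px Px′ fμ fμ′ eq =
        +-cancelʳ (μ * e) x x′ (trans eq (+-congˡ (*-congʳ (sym μ≈μ′)))) , μ≈μ′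
        where
        μ≈μ′ : μ ≈ μ′
        μ≈μ′ = *-cancelˡ-nonzero z≉0 (trans (*-comm z μ) (trans (sym (value Px fμ))
          (trans (operator-cong (suc j) (p F) eq) (trans (value Px′ fμ′) (*-comm μ′ z)))))

      onto : ∀ y → P′ y ≈ 0# → ∃₂ λ x μ → P x ≈ 0# × σ μ ≈ μ × y ≈ x + μ * e
      onto y P′y≈0 = y + - μ * e , μ , Px≈0 , σμ≈μ
        , solve 3 (λ y μ e → y := y :+ (:- μ) :* e :+ μ :* e) refl y μ e
        where
        -- The only scalar for which P (y - μ e) can vanish. It is fixed because P′ y is σμ - μ.
        μ = w * P y

        σμ≈μ : σ μ ≈ μ
        σμ≈μ = x∙y⁻¹≈ε⇒x≈y _ _ (trans (sym (P′-value y)) P′y≈0)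

        Px≈0 : P (y + - μ * e) ≈ 0#
        Px≈0 = begin
          P (y + - μ * e)       ≈⟨ operator-linear (suc j) (p F) (trans (φ-neg μ) (-‿cong σμ≈μ)) y e ⟩
          P y + - (w * P y) * z ≈⟨ solve 3 (λ p w z → p :+ :- (w :* p) :* z := p :- z :* (w :* p)) refl _ w z ⟩
          P y - z * (w * P y)   ≈⟨ +-congˡ (-‿cong (z*w* (P y))) ⟩
          P y - P y             ≈⟨ -‿inverseʳ _ ⟩
          0#                    ∎

    -- At r = 0 the left factor is multiplication by a non-zero scalar, so the right factor kills
    -- everything and its kernel of size kⁿ is the whole field.
    full : ∀ r j → j ℕ.+ r ≡ n → Factorisation j r → k ^ n ≡ q ^ n
    full zero j j+0≡n F with ≡.trans (≡.sym (ℕ.+-identityʳ j)) j+0≡n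
    ... | ≡.refl = HasExactly-unique (kernel F) all-elements (λ _ _ → refl)
      (λ x _ → *-zero-cancelʳ (s-lead F) (trans (*-comm _ _)
        (trans (sym (+-identityˡ _)) (annihilates F x))))
    full (suc r) j j+r≡n F = full r (suc j) (≡.trans (≡.sym (ℕ.+-suc j r)) j+r≡n)
      (extend (≡.subst (j <_) j+r≡n (ℕ.m<m+n j ℕ.z<s)) F)

  fixed-field : HasExactly q (λ x → σ x ≈ x)
  fixed-field = ≡.subst (λ l → HasExactly l (λ x → σ x ≈ x)) (^-cancelʳ-≡ n k q 1≤n k^n≡q^n)
    (proj₂ fixed-finite)
    where
    1≤n : 1 ≤ n
    1≤n = ℕ.≤-trans (ℕ.n≤1+n 1) 2≤n

    k^n≡q^n : k ^ n ≡ q ^ n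
    k^n≡q^n = full (pred n) 1 (ℕ.suc-pred n {{ℕ.>-nonZero 1≤n}}) (first (ℕ.suc-pred n {{ℕ.>-nonZero 1≤n}}))

-- The recurrence along an orbit and its fundamental solutions.

-- The equation L x = 0 reads σ²x = − β σx − α x with α = a/c and β = b/c.
module Recurrence {c ℓ} (R : CommutativeRing c ℓ)
  (σ : CommutativeRing.Carrier R → CommutativeRing.Carrier R)
  (σ-aut : Setup.IsRingAut R σ) (α β : CommutativeRing.Carrier R) where
  open CommutativeRing R
  open import Algebra.Properties.Ring ring
  open import Relation.Binary.Reasoning.Setoid setoid
  open Setup R
  open IntegerCoefficients R
  open Automorphism R σ σ-aut

  -- For a root x of L, the value orbit x (σ x) k is σᵏ x.
  orbit : Carrier → Carrier → ℕ → Carrier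
  orbit v w zero          = v
  orbit v w (suc zero)    = w
  orbit v w (suc (suc k)) =
    - (iter σ k β * orbit v w (suc k)) - iter σ k α * orbit v w k

  X Y : ℕ → Carrier
  X = orbit 1# 0#
  Y = orbit 0# 1#

  orbit-linear : ∀ v w k → orbit v w k ≈ X k * v + Y k * w
  orbit-linear v w zero =
    solve 2 (λ v w → v := con (pos 1) :* v :+ con (pos 0) :* w) refl v w
  orbit-linear v w (suc zero) =
    solve 2 (λ v w → w := con (pos 0) :* v :+ con (pos 1) :* w) refl v w
  orbit-linear v w (suc (suc k)) = begin
    - (s * orbit v w (suc k)) - t * orbit v w k
      ≈⟨ +-cong (-‿cong (*-congˡ (orbit-linear v w (suc k)))) (-‿cong (*-congˡ (orbit-linear v w k))) ⟩
    - (s * (X (suc k) * v + Y (suc k) * w)) - t * (X k * v + Y k * w)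
      ≈⟨ solve 8 (λ s t x x′ y y′ v w →
           :- (s :* (x′ :* v :+ y′ :* w)) :- t :* (x :* v :+ y :* w) :=
           (:- (s :* x′) :- t :* x) :* v :+ (:- (s :* y′) :- t :* y) :* w)
           refl s t (X k) (X (suc k)) (Y k) (Y (suc k)) v w ⟩
    X (suc (suc k)) * v + Y (suc (suc k)) * w ∎
    where
    s = iter σ k β
    t = iter σ k α

  private
    step-cong : ∀ {s s′ t t′ x x′ y y′} → s ≈ s′ → t ≈ t′ → x ≈ x′ → y ≈ y′ →
      - (s * x) - t * y ≈ - (s′ * x′) - t′ * y′
    step-cong s≈ t≈ x≈ y≈ = +-cong (-‿cong (*-cong s≈ x≈)) (-‿cong (*-cong t≈ y≈))

    φ-step : ∀ s t x y → σ (- (s * x) - t * y) ≈ - (σ s * σ x) - σ t * σ y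
    φ-step s t x y = trans (φ-sub _ _)
      (+-cong (trans (φ-neg _) (-‿cong (φ-* _ _))) (-‿cong (φ-* _ _)))

  orbit-root : ∀ {x} → σ (σ x) ≈ - (β * σ x) - α * x → ∀ k → orbit x (σ x) k ≈ iter σ k x
  orbit-root root zero          = refl
  orbit-root root (suc zero)    = refl
  orbit-root {x} root (suc (suc k)) = begin
    - (iter σ k β * orbit x (σ x) (suc k)) - iter σ k α * orbit x (σ x) k
      ≈⟨ step-cong refl refl (trans (orbit-root root (suc k)) (reflexive (≡.sym (iter-φ k x))))
                             (orbit-root root k) ⟩
    - (iter σ k β * iter σ k (σ x)) - iter σ k α * iter σ k x
      ≈⟨ +-cong (-‿cong (iter-* k _ _)) (-‿cong (iter-* k _ _)) ⟨
    - iter σ k (β * σ x) - iter σ k (α * x)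
      ≈⟨ +-congʳ (iter-neg k _) ⟨
    iter σ k (- (β * σ x)) - iter σ k (α * x)
      ≈⟨ iter-sub k _ _ ⟨
    iter σ k (- (β * σ x) - α * x)
      ≈⟨ iter-cong k root ⟨
    iter σ k (σ (σ x))
      ≡⟨ ≡.trans (iter-φ k (σ x)) (≡.cong σ (iter-φ k x)) ⟩
    iter σ (suc (suc k)) x ∎
    where
    iter-neg : ∀ k y → iter σ k (- y) ≈ - iter σ k y
    iter-neg zero    y = refl
    iter-neg (suc k) y = trans (φ-cong (iter-neg k y)) (φ-neg _)

  -- The shift of a solution solves the σ-conjugate recurrence, as σ(Y k) does. The shift of `X`
  -- starts with 0 , - α, which is - α times the start of σ(Y k).
  X-suc : ∀ k → X (suc k) ≈ - (α * σ (Y k))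
  X-suc zero = sym (trans (-‿cong (trans (*-congˡ φ-0) (zeroʳ α))) -0#≈0#)
  X-suc (suc zero) = begin
    - (β * 0#) - α * 1#  ≈⟨ solve 2 (λ α β → :- (β :* con (pos 0)) :- α :* con (pos 1) := :- (α :* con (pos 1))) refl α β ⟩
    - (α * 1#)           ≈⟨ -‿cong (*-congˡ φ-1) ⟨
    - (α * σ 1#)         ∎
  X-suc (suc (suc k)) = begin
    - (s * X (suc (suc k))) - t * X (suc k)
      ≈⟨ step-cong refl refl (X-suc (suc k)) (X-suc k) ⟩
    - (s * - (α * σ (Y (suc k)))) - t * - (α * σ (Y k))
      ≈⟨ solve 5 (λ s t α y y′ → :- (s :* :- (α :* y′)) :- t :* :- (α :* y) :=
           :- (α :* (:- (s :* y′) :- t :* y))) refl s t α _ _ ⟩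
    - (α * (- (s * σ (Y (suc k))) - t * σ (Y k)))
      ≈⟨ -‿cong (*-congˡ (φ-step _ _ _ _)) ⟨
    - (α * σ (Y (suc (suc k)))) ∎
    where
    s = iter σ (suc k) β
    t = iter σ (suc k) α

  -- As for `X-suc`: the shift of `Y` starts with 1 , - β. The two identities together are A_{k+1} =
  -- σ(A_k) A_1.
  Y-suc : ∀ k → Y (suc k) ≈ σ (X k) - β * σ (Y k)
  Y-suc zero = sym (begin
    σ 1# - β * σ 0#  ≈⟨ +-cong φ-1 (-‿cong (*-congˡ φ-0)) ⟩
    1# - β * 0#      ≈⟨ solve 1 (λ β → con (pos 1) :- β :* con (pos 0) := con (pos 1)) refl β ⟩
    1#               ∎)
  Y-suc (suc zero) = begin
    - (β * 1#) - α * 0#  ≈⟨ solve 2 (λ α β → :- (β :* con (pos 1)) :- α :* con (pos 0) := con (pos 0) :- β :* con (pos 1)) refl α β ⟩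
    0# - β * 1#          ≈⟨ +-cong φ-0 (-‿cong (*-congˡ φ-1)) ⟨
    σ 0# - β * σ 1#      ∎
  Y-suc (suc (suc k)) = begin
    - (s * Y (suc (suc k))) - t * Y (suc k)
      ≈⟨ step-cong refl refl (Y-suc (suc k)) (Y-suc k) ⟩
    - (s * (σ (X (suc k)) - β * σ (Y (suc k)))) - t * (σ (X k) - β * σ (Y k))
      ≈⟨ solve 7 (λ s t β x x′ y y′ →
           :- (s :* (x′ :- β :* y′)) :- t :* (x :- β :* y) :=
           (:- (s :* x′) :- t :* x) :- β :* (:- (s :* y′) :- t :* y)) refl s t β _ _ _ _ ⟩
    (- (s * σ (X (suc k))) - t * σ (X k)) - β * (- (s * σ (Y (suc k))) - t * σ (Y k))
      ≈⟨ +-cong (φ-step _ _ _ _) (-‿cong (*-congˡ (φ-step _ _ _ _))) ⟨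
    σ (X (suc (suc k))) - β * σ (Y (suc (suc k))) ∎
    where
    s = iter σ (suc k) β
    t = iter σ (suc k) α

  -- The left side is det A_k, and one step of the recurrence multiplies A_k by a companion matrix
  -- of determinant σᵏα.
  casoratian : ∀ k → X k * Y (suc k) - Y k * X (suc k) ≈ norm σ k α
  casoratian zero = solve 0 (con (pos 1) :* con (pos 1) :- con (pos 0) :* con (pos 0) := con (pos 1)) refl
  casoratian (suc k) = begin
    X (suc k) * Y (suc (suc k)) - Y (suc k) * X (suc (suc k))
      ≈⟨ solve 6 (λ s t x x′ y y′ →
           x′ :* (:- (s :* y′) :- t :* y) :- y′ :* (:- (s :* x′) :- t :* x) :=
           (x :* y′ :- y :* x′) :* t) refl _ _ _ _ _ _ ⟩
    (X k * Y (suc k) - Y k * X (suc k)) * iter σ k α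
      ≈⟨ *-congʳ (casoratian k) ⟩
    norm σ (suc k) α ∎

primePower>1 : ∀ {q} → IsPrimePower q → 1 < q
primePower>1 (p , k , p-prime , 1≤k , ≡.refl) = ℕ.<-≤-trans 1<p
  (≡.subst (_≤ p ^ k) (ℕ.^-identityʳ p) (ℕ.^-monoʳ-≤ p {{ℕ.>-nonZero (ℕ.<⇒≤ 1<p)}} 1≤k))
  where
  1<p : 1 < p
  1<p = ℕ.nonTrivial⇒n>1 p {{prime⇒nonTrivial p-prime}}

-- Roots of L, and the trace and determinant of the monodromy.

module Roots {c ℓ} (R : CommutativeRing c ℓ) (q n : ℕ) (2≤n : 2 ≤ n)
  (finite : Setup.IsFiniteFieldOfSize R (q ^ n))
  (σ : CommutativeRing.Carrier R → CommutativeRing.Carrier R)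
  (galois : Setup.IsGaloisGenerator R q n σ)
  (a b c′ ci : CommutativeRing.Carrier R)
  (ac≉0 : ¬ (CommutativeRing._≈_ R (CommutativeRing._*_ R a c′) (CommutativeRing.0# R)))
  (c*ci≈1 : CommutativeRing._≈_ R (CommutativeRing._*_ R c′ ci) (CommutativeRing.1# R))
  where
  open CommutativeRing R
  open import Algebra.Properties.Ring ring
  open import Relation.Binary.Reasoning.Setoid setoid
  open Setup R
  open Sums R
  open IntegerCoefficients R
  open Counting R
  open FiniteField R finite
  open FixedField R q n 2≤n finite σ galois
  open Automorphism R σ σ-aut

  private
    α β : Carrier
    α = a * ci
    β = b * ci

  open Recurrence R σ σ-aut α β

  Root : Carrier → Set ℓ
  Root x = Lmap σ a b c′ x ≈ 0#

  Split : Set ℓ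
  Split = (H σ a b ci (pred n) ≈ 0#) × (H σ a b ci n ≈ 1#)

  D : Carrier
  D = 1# - E σ a b ci n + norm σ n (a * ci)

  α≉0 : ¬ (α ≈ 0#)
  α≉0 α≈0 = ac≉0 (begin
    a * c′              ≈⟨ *-congʳ a≈0 ⟩
    0# * c′             ≈⟨ zeroˡ c′ ⟩
    0#                  ∎)
    where
    a≈0 : a ≈ 0#
    a≈0 = begin
      a             ≈⟨ *-identityʳ a ⟨
      a * 1#        ≈⟨ *-congˡ c*ci≈1 ⟨
      a * (c′ * ci) ≈⟨ solve 3 (λ a c i → a :* (c :* i) := a :* i :* c) refl a c′ ci ⟩
      α * c′        ≈⟨ *-congʳ α≈0 ⟩
      0# * c′       ≈⟨ zeroˡ c′ ⟩
      0#            ∎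

  Lmap-monic : ∀ x → Lmap σ a b c′ x ≈ c′ * (σ (σ x) - (- (β * σ x) - α * x))
  Lmap-monic x = sym (begin
    c′ * (σ (σ x) - (- (β * σ x) - α * x))
      ≈⟨ solve 7 (λ a b c i x y z →
           c :* (z :- (:- (b :* i :* y) :- a :* i :* x)) :=
           a :* (c :* i) :* x :+ b :* (c :* i) :* y :+ c :* z)
           refl a b c′ ci x (σ x) (σ (σ x)) ⟩
    a * (c′ * ci) * x + b * (c′ * ci) * σ x + c′ * σ (σ x)
      ≈⟨ +-congʳ (+-cong (*-congʳ (*1 a)) (*-congʳ (*1 b))) ⟩
    Lmap σ a b c′ x ∎)
    where
    *1 : ∀ y → y * (c′ * ci) ≈ y
    *1 y = trans (*-congˡ c*ci≈1) (*-identityʳ y)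

  c′≉0 : ¬ (c′ ≈ 0#)
  c′≉0 c′≈0 = ac≉0 (trans (*-congˡ c′≈0) (zeroʳ a))

  Root⇒σ² : ∀ {x} → Root x → σ (σ x) ≈ - (β * σ x) - α * x
  Root⇒σ² {x} root = x∙y⁻¹≈ε⇒x≈y _ _
    (*-cancelˡ-nonzero c′≉0 (trans (sym (Lmap-monic x)) (trans root (sym (zeroʳ c′)))))

  σ²⇒Root : ∀ {x} → σ (σ x) ≈ - (β * σ x) - α * x → Root x
  σ²⇒Root {x} eq = trans (Lmap-monic x) (trans (*-congˡ (x≈y⇒x∙y⁻¹≈ε eq)) (zeroʳ c′))

  Lmap-cong : ∀ {x y} → x ≈ y → Lmap σ a b c′ x ≈ Lmap σ a b c′ y
  Lmap-cong x≈y = +-cong (+-cong (*-congˡ x≈y) (*-congˡ (φ-cong x≈y))) (*-congˡ (φ-cong (φ-cong x≈y)))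

  Root-combination : ∀ {μ ν x y} → σ μ ≈ μ → σ ν ≈ ν → Root x → Root y → Root (μ * x + ν * y)
  Root-combination {μ} {ν} {x} {y} fμ fν rx ry = begin
    a * (μ * x + ν * y) + b * σ (μ * x + ν * y) + c′ * σ (σ (μ * x + ν * y))
      ≈⟨ +-cong (+-congˡ (*-congˡ (σ-comb x y)))
                (*-congˡ (trans (φ-cong (σ-comb x y)) (σ-comb (σ x) (σ y)))) ⟩
    a * (μ * x + ν * y) + b * (μ * σ x + ν * σ y) + c′ * (μ * σ (σ x) + ν * σ (σ y))
      ≈⟨ (let x₁ = σ x; x₂ = σ (σ x); y₁ = σ y; y₂ = σ (σ y) in
         solve 11 (λ a b c μ ν x y x₁ y₁ x₂ y₂ →
           a :* (μ :* x :+ ν :* y) :+ b :* (μ :* x₁ :+ ν :* y₁) :+ c :* (μ :* x₂ :+ ν :* y₂) :=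
           μ :* (a :* x :+ b :* x₁ :+ c :* x₂) :+ ν :* (a :* y :+ b :* y₁ :+ c :* y₂))
           refl a b c′ μ ν x y x₁ y₁ x₂ y₂) ⟩
    μ * Lmap σ a b c′ x + ν * Lmap σ a b c′ y
      ≈⟨ +-cong (trans (*-congˡ rx) (zeroʳ μ)) (trans (*-congˡ ry) (zeroʳ ν)) ⟩
    0# + 0#
      ≈⟨ +-identityˡ 0# ⟩
    0# ∎
    where
    σ-comb : ∀ x y → σ (μ * x + ν * y) ≈ μ * σ x + ν * σ y
    σ-comb x y = trans (φ-+ _ _)
      (+-cong (trans (φ-* _ _) (*-congʳ fμ)) (trans (φ-* _ _) (*-congʳ fν)))

  Root-0 : Root 0#
  Root-0 = begin
    a * 0# + b * σ 0# + c′ * σ (σ 0#)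
      ≈⟨ +-cong (+-congˡ (*-congˡ φ-0)) (*-congˡ (trans (φ-cong φ-0) φ-0)) ⟩
    a * 0# + b * 0# + c′ * 0#
      ≈⟨ solve 3 (λ a b c → a :* con (pos 0) :+ b :* con (pos 0) :+ c :* con (pos 0) := con (pos 0)) refl a b c′ ⟩
    0# ∎

  -- The recurrences agree; the index shifts because `Y` has a 0 in front of the initial value 1 of
  -- `H`.
  H≈Y : ∀ k → H σ a b ci k ≈ Y (suc k)
  H≈Y zero          = refl
  H≈Y (suc zero)    = solve 2 (λ α β → :- β := :- (β :* con (pos 1)) :- α :* con (pos 0)) refl α β
  H≈Y (suc (suc k)) =
    +-cong (-‿cong (*-congˡ (H≈Y (suc k)))) (-‿cong (*-congˡ (H≈Y k)))

  H-pred≈Y : H σ a b ci (pred n) ≈ Y n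
  H-pred≈Y = trans (H≈Y (pred n))
    (reflexive (≡.cong Y (ℕ.suc-pred n {{ℕ.>-nonZero (ℕ.<⇒≤ 2≤n)}})))

  -- The monodromy matrix (X n , Y n ; X (n+1) , Y (n+1)) sends (x , σx) to (σⁿx , σⁿ⁺¹x); it is
  -- conjugate to its image under σ, and this is its trace.
  E≈trace : E σ a b ci n ≈ X n + Y (suc n)
  E≈trace = begin
    H σ a b ci n + σ (H σ a b ci n) + β * σ (H σ a b ci (pred n))
      ≈⟨ +-cong (+-cong (H≈Y n) (φ-cong (H≈Y n))) (*-congˡ (φ-cong H-pred≈Y)) ⟩
    Y (suc n) + σ (Y (suc n)) + β * σ (Y n)
      ≈⟨ +-congʳ (+-congˡ σY) ⟩
    Y (suc n) + (X n - β * σ (Y n)) + β * σ (Y n)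
      ≈⟨ solve 3 (λ x y z → y :+ (x :- z) :+ z := x :+ y) refl _ _ _ ⟩
    X n + Y (suc n) ∎
    where
    -- `X (suc (suc n))` is computed twice, by `X-suc` and by the recurrence, where σⁿ = 1 turns the
    -- coefficients back into α and β. Then α cancels.
    σY : σ (Y (suc n)) ≈ X n - β * σ (Y n)
    σY = *-cancelˡ-nonzero α≉0 (begin
      α * σ (Y (suc n))
        ≈⟨ -‿involutive _ ⟨
      - - (α * σ (Y (suc n)))
        ≈⟨ -‿cong (X-suc (suc n)) ⟨
      - (- (iter σ n β * X (suc n)) - iter σ n α * X n)
        ≈⟨ -‿cong (+-cong (-‿cong (*-cong (σⁿ β) (X-suc n))) (-‿cong (*-congʳ (σⁿ α)))) ⟩
      - (- (β * - (α * σ (Y n))) - α * X n)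
        ≈⟨ solve 4 (λ α β x y → :- (:- (β :* :- (α :* y)) :- α :* x) := α :* (x :- β :* y))
             refl α β _ _ ⟩
      α * (X n - β * σ (Y n)) ∎)

  -- The characteristic polynomial of A at 1 is 1 - trace + determinant, and `casoratian` identifies
  -- the determinant with the norm of α.
  D≈det : D ≈ (X n - 1#) * (Y (suc n) - 1#) - Y n * X (suc n)
  D≈det = begin
    1# - E σ a b ci n + norm σ n α
      ≈⟨ +-cong (+-congˡ (-‿cong E≈trace)) (sym (casoratian n)) ⟩
    1# - (X n + Y (suc n)) + (X n * Y (suc n) - Y n * X (suc n))
      ≈⟨ solve 4 (λ x y x′ y′ →
           con (pos 1) :- (x :+ y′) :+ (x :* y′ :- y :* x′) :=
           (x :- con (pos 1)) :* (y′ :- con (pos 1)) :- y :* x′) refl _ _ _ _ ⟩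
    (X n - 1#) * (Y (suc n) - 1#) - Y n * X (suc n) ∎

  -- The inverse of σ, and descent from fixed vectors to roots.

  τ : Carrier → Carrier
  τ y = proj₁ (φ-surjective y)

  σ∘τ : ∀ y → σ (τ y) ≈ y
  σ∘τ y = proj₂ (φ-surjective y)

  τ∘σ : ∀ x → τ (σ x) ≈ x
  τ∘σ x = φ-injective (σ∘τ (σ x))

  τ-aut : IsRingAut τ
  τ-aut =
      (λ x≈y → φ-injective (trans (σ∘τ _) (trans x≈y (sym (σ∘τ _)))))
    , (λ x y → φ-injective (trans (σ∘τ _) (sym (trans (φ-+ _ _) (+-cong (σ∘τ x) (σ∘τ y))))))
    , (λ x y → φ-injective (trans (σ∘τ _) (sym (trans (φ-* _ _) (*-cong (σ∘τ x) (σ∘τ y))))))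
    , φ-injective (trans (σ∘τ 1#) (sym φ-1))
    , (λ x y eq → trans (sym (σ∘τ x)) (trans (φ-cong eq) (σ∘τ y)))
    , (λ y → σ y , τ∘σ y)

  module τ = Automorphism R τ τ-aut

  σᵐ∘τᵐ : ∀ m x → iter σ m (iter τ m x) ≈ x
  σᵐ∘τᵐ zero    x = refl
  σᵐ∘τᵐ (suc m) x = trans (reflexive (≡.sym (iter-φ m _)))
    (trans (iter-cong m (σ∘τ _)) (σᵐ∘τᵐ m x))

  τᵐ∘σᵐ : ∀ m x → iter τ m (iter σ m x) ≈ x
  τᵐ∘σᵐ m x = iter-injective m (σᵐ∘τᵐ m _)

  τⁿ : ∀ x → iter τ n x ≈ x
  τⁿ x = trans (τ.iter-cong n (sym (σⁿ x))) (τᵐ∘σᵐ n x)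

  τ-moves : ∀ m → 1 ≤ m → m < n → ∃ λ x → ¬ (iter τ m x ≈ x)
  τ-moves m 1≤m m<n =
    let (x , σᵐx≉x) = σ-moves m 1≤m m<n in
    x , λ τᵐx≈x → σᵐx≉x (trans (iter-cong m (sym τᵐx≈x)) (σᵐ∘τᵐ m x))

  -- As σ τⁱ⁺¹ = τⁱ, applying σ shifts the index of `u`; the sum closes up because τⁿ = 1 and `u n`
  -- agrees with `u 0`.
  σ-twistedTrace : ∀ (u : ℕ → Carrier) → u n ≈ u 0 →
    σ (sum n (λ i → iter τ i (u i))) ≈ sum n (λ i → iter τ i (u (suc i)))
  σ-twistedTrace u uₙ≈u₀ = begin
    σ (sum n (λ i → iter τ i (u i)))
      ≈⟨ φ-sum n _ ⟩
    sum n (λ i → σ (iter τ i (u i)))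
      ≈⟨ sum-rotate n _ (φ-cong (trans (τⁿ _) uₙ≈u₀)) ⟨
    sum n (λ i → σ (iter τ (suc i) (u (suc i))))
      ≈⟨ sum-cong n (λ i → σ∘τ _) ⟩
    sum n (λ i → iter τ i (u (suc i))) ∎

  -- Hilbert 90 in trace form: if the monodromy fixes (v , w), then Σᵢ σ⁻ⁱ(λ sᵢ), with s the orbit
  -- of (v , w), is a root for every λ.
  descent : ∀ v w → orbit v w n ≈ v → orbit v w (suc n) ≈ w →
    ∀ f g → ¬ (f * v + g * w ≈ 0#) → ∃ λ x → Root x × ¬ (f * x + g * σ x ≈ 0#)
  descent v w sₙ≈v sₙ₊₁≈w f g fv+gw≉0 = x , σ²⇒Root σ²x , value≉0
    where
    s = orbit v w

    -- As a function of λ, the value f x + g σx is a combination of the powers of τ with these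
    -- coefficients. The one at 0 is f v + g w, which is non-zero.
    coefficient : ℕ → Carrier
    coefficient i = f * iter τ i (s i) + g * iter τ i (s (suc i))

    good : ∃ λ l → ¬ (τ.operator n coefficient l ≈ 0#)
    good = Characters.nonvanishing τ τ-aut n τ-moves n ℕ.≤-refl coefficient 0
      (ℕ.<⇒≤ 2≤n) fv+gw≉0

    l = proj₁ good

    x : Carrier
    x = sum n (λ i → iter τ i (l * s i))

    σx : σ x ≈ sum n (λ i → iter τ i (l * s (suc i)))
    σx = σ-twistedTrace (λ i → l * s i) (*-congˡ sₙ≈v)

    σ²x : σ (σ x) ≈ - (β * σ x) - α * x
    σ²x = begin
      σ (σ x)
        ≈⟨ φ-cong σx ⟩
      σ (sum n (λ i → iter τ i (l * s (suc i))))
        ≈⟨ σ-twistedTrace (λ i → l * s (suc i)) (*-congˡ sₙ₊₁≈w) ⟩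
      sum n (λ i → iter τ i (l * s (suc (suc i))))
        ≈⟨ sum-cong n term ⟩
      sum n (λ i → - β * iter τ i (l * s (suc i)) + - α * iter τ i (l * s i))
        ≈⟨ sum-linear n (- α) _ _ ⟩
      sum n (λ i → - β * iter τ i (l * s (suc i))) + - α * x
        ≈⟨ +-congʳ (trans (sum-*ˡ n (- β) _) (*-congˡ (sym σx))) ⟩
      - β * σ x + - α * x
        ≈⟨ +-cong (-‿distribˡ-* β _) (-‿distribˡ-* α x) ⟨
      - (β * σ x) - α * x ∎
      where
      term : ∀ i → iter τ i (l * s (suc (suc i))) ≈
        - β * iter τ i (l * s (suc i)) + - α * iter τ i (l * s i)
      term i = begin
        iter τ i (l * (- (iter σ i β * s (suc i)) - iter σ i α * s i))
          ≈⟨ τ.iter-cong i (solve 5 (λ l p t q u →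
               l :* (:- (p :* t) :- q :* u) := p :* (con (pos 0) :- l :* t) :- q :* (l :* u))
               refl l (iter σ i β) (s (suc i)) (iter σ i α) (s i)) ⟩
        iter τ i (iter σ i β * (0# - l * s (suc i)) - iter σ i α * (l * s i))
          ≈⟨ τ.iter-sub i _ _ ⟩
        iter τ i (iter σ i β * (0# - l * s (suc i))) - iter τ i (iter σ i α * (l * s i))
          -- Here τⁱ undoes the twist: σⁱβ and σⁱα become β and α for every `i`, so one equation
          -- holds for the whole sum.
          ≈⟨ +-cong (trans (τ.iter-* i _ _) (*-cong (τᵐ∘σᵐ i β)
                      (trans (τ.iter-sub i _ _) (+-congʳ (τ.iter-0 i)))))
                    (-‿cong (trans (τ.iter-* i _ _) (*-congʳ (τᵐ∘σᵐ i α)))) ⟩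
        β * (0# - iter τ i (l * s (suc i))) - α * iter τ i (l * s i)
          ≈⟨ solve 4 (λ β α t u →
               β :* (con (pos 0) :- t) :- α :* u := (:- β) :* t :+ (:- α) :* u) refl β α _ _ ⟩
        - β * iter τ i (l * s (suc i)) + - α * iter τ i (l * s i) ∎

    value≉0 : ¬ (f * x + g * σ x ≈ 0#)
    value≉0 eq = proj₂ good (begin
      τ.operator n coefficient l
        ≈⟨ sum-cong n (λ i → trans
             (solve 5 (λ f g t u l → (f :* t :+ g :* u) :* l := f :* (l :* t) :+ g :* (l :* u))
               refl f g (iter τ i (s i)) (iter τ i (s (suc i))) (iter τ i l))
             (+-cong (*-congˡ (sym (τ.iter-* i _ _))) (*-congˡ (sym (τ.iter-* i _ _))))) ⟩
      sum n (λ i → f * iter τ i (l * s i) + g * iter τ i (l * s (suc i)))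
        ≈⟨ sum-linear n g _ _ ⟩
      sum n (λ i → f * iter τ i (l * s i)) + g * sum n (λ i → iter τ i (l * s (suc i)))
        ≈⟨ +-cong (sum-*ˡ n f _) (*-congˡ (sym σx)) ⟩
      f * x + g * σ x
        ≈⟨ eq ⟩
      0# ∎)

  -- Fixed vectors of the monodromy and the vanishing of `D`.

  Split⇒X≈1 : Y n ≈ 0# → Y (suc n) ≈ 1# → X n ≈ 1#
  Split⇒X≈1 Yₙ≈0 Yₙ₊₁≈1 = φ-injective (begin
    σ (X n)                             ≈⟨ solve 2 (λ x y → x := (x :- y) :+ y) refl (σ (X n)) (β * σ (Y n)) ⟩
    (σ (X n) - β * σ (Y n)) + β * σ (Y n)
      ≈⟨ +-cong (sym (Y-suc n)) (*-congˡ (trans (φ-cong Yₙ≈0) φ-0)) ⟩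
    Y (suc n) + β * 0#                  ≈⟨ +-cong Yₙ₊₁≈1 (zeroʳ β) ⟩
    1# + 0#                             ≈⟨ +-identityʳ 1# ⟩
    1#                                  ≈⟨ φ-1 ⟨
    σ 1#                                ∎)

  Y≈0⇒X-suc≈0 : Y n ≈ 0# → X (suc n) ≈ 0#
  Y≈0⇒X-suc≈0 Yₙ≈0 = begin
    X (suc n)           ≈⟨ X-suc n ⟩
    - (α * σ (Y n))     ≈⟨ -‿cong (*-congˡ (trans (φ-cong Yₙ≈0) φ-0)) ⟩
    - (α * 0#)          ≈⟨ solve 1 (λ α → :- (α :* con (pos 0)) := con (pos 0)) refl α ⟩
    0#                  ∎

  module _ (Yₙ≈0 : Y n ≈ 0#) (Yₙ₊₁≈1 : Y (suc n) ≈ 1#) where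

    Split⇒orbit : ∀ v w → orbit v w n ≈ v
    Split⇒orbit v w = begin
      orbit v w n        ≈⟨ orbit-linear v w n ⟩
      X n * v + Y n * w  ≈⟨ +-cong (*-congʳ (Split⇒X≈1 Yₙ≈0 Yₙ₊₁≈1)) (*-congʳ Yₙ≈0) ⟩
      1# * v + 0# * w    ≈⟨ solve 2 (λ v w → con (pos 1) :* v :+ con (pos 0) :* w := v) refl v w ⟩
      v                  ∎

    Split⇒orbit-suc : ∀ v w → orbit v w (suc n) ≈ w
    Split⇒orbit-suc v w = begin
      orbit v w (suc n)              ≈⟨ orbit-linear v w (suc n) ⟩
      X (suc n) * v + Y (suc n) * w  ≈⟨ +-cong (*-congʳ (Y≈0⇒X-suc≈0 Yₙ≈0)) (*-congʳ Yₙ₊₁≈1) ⟩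
      0# * v + 1# * w                ≈⟨ solve 2 (λ v w → con (pos 0) :* v :+ con (pos 1) :* w := w) refl v w ⟩
      w                              ∎

  Split⇒D≈0 : Split → D ≈ 0#
  Split⇒D≈0 (h₀ , h₁) = begin
    D
      ≈⟨ D≈det ⟩
    (X n - 1#) * (Y (suc n) - 1#) - Y n * X (suc n)
      ≈⟨ +-cong (*-congˡ (x≈y⇒x∙y⁻¹≈ε (trans (sym (H≈Y n)) h₁)))
                (-‿cong (*-congʳ (trans (sym H-pred≈Y) h₀))) ⟩
    (X n - 1#) * 0# - 0# * X (suc n)
      ≈⟨ solve 2 (λ x y → (x :- con (pos 1)) :* con (pos 0) :- con (pos 0) :* y := con (pos 0)) refl _ _ ⟩
    0# ∎

  fixedVector⇒Root : ∀ {v w} → orbit v w n ≈ v → orbit v w (suc n) ≈ w → ¬ (v ≈ 0#) →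
    ∃ λ x → Root x × ¬ (x ≈ 0#)
  fixedVector⇒Root {v} {w} sₙ≈v sₙ₊₁≈w v≉0 =
    let (x , root , value≉0) = descent v w sₙ≈v sₙ₊₁≈w 1# 0# (λ eq → v≉0 (trans (sym (first v w)) eq)) in
    x , root , λ x≈0 → value≉0 (trans (first x (σ x)) x≈0)
    where
    first : ∀ y z → 1# * y + 0# * z ≈ y
    first = solve 2 (λ y z → con (pos 1) :* y :+ con (pos 0) :* z := y) refl

  -- If `Y n` vanishes, then `Y (suc n)` is σ(X n) and the determinant is (X n - 1)(σ(X n) - 1).
  -- Hence both diagonal entries are 1, A is the identity, and (1 , 0) is fixed.
  D≈0⇒Root : D ≈ 0# → ∃ λ x → Root x × ¬ (x ≈ 0#)
  D≈0⇒Root D≈0 with Y n ≈? 0#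
  ... | yes Yₙ≈0 = fixedVector⇒Root (Split⇒orbit Yₙ≈0 Yₙ₊₁≈1 1# 0#) (Split⇒orbit-suc Yₙ≈0 Yₙ₊₁≈1 1# 0#) 1≉0
    where
    Yₙ₊₁≈σX : Y (suc n) ≈ σ (X n)
    Yₙ₊₁≈σX = begin
      Y (suc n)              ≈⟨ Y-suc n ⟩
      σ (X n) - β * σ (Y n)  ≈⟨ +-congˡ (-‿cong (*-congˡ (trans (φ-cong Yₙ≈0) φ-0))) ⟩
      σ (X n) - β * 0#       ≈⟨ solve 2 (λ x β → x :- β :* con (pos 0) := x) refl _ β ⟩
      σ (X n)                ∎

    product≈0 : (X n - 1#) * (Y (suc n) - 1#) ≈ 0#
    product≈0 = begin
      (X n - 1#) * (Y (suc n) - 1#)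
        ≈⟨ solve 2 (λ p x → p := p :- con (pos 0) :* x) refl _ (X (suc n)) ⟩
      (X n - 1#) * (Y (suc n) - 1#) - 0# * X (suc n)
        ≈⟨ +-congˡ (-‿cong (*-congʳ Yₙ≈0)) ⟨
      (X n - 1#) * (Y (suc n) - 1#) - Y n * X (suc n)
        ≈⟨ trans (sym D≈det) D≈0 ⟩
      0# ∎

    Yₙ₊₁≈1 : Y (suc n) ≈ 1#
    Yₙ₊₁≈1 with Y (suc n) ≈? 1#
    ... | yes eq = eq
    ... | no neq = trans Yₙ₊₁≈σX (trans
      (φ-cong (x∙y⁻¹≈ε⇒x≈y _ _ (*-zero-cancelʳ (x-y≉0 neq) product≈0))) φ-1)
  -- The vector (Y n , 1 - X n) is annihilated by the first row of A - 1 identically, and by the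
  -- second row because the determinant is zero.
  ... | no Yₙ≉0 = fixedVector⇒Root first second Yₙ≉0
    where
    first : orbit (Y n) (1# - X n) n ≈ Y n
    first = trans (orbit-linear _ _ n)
      (solve 2 (λ x y → x :* y :+ y :* (con (pos 1) :- x) := y) refl (X n) (Y n))

    second : orbit (Y n) (1# - X n) (suc n) ≈ 1# - X n
    second = begin
      orbit (Y n) (1# - X n) (suc n)
        ≈⟨ orbit-linear _ _ (suc n) ⟩
      X (suc n) * Y n + Y (suc n) * (1# - X n)
        ≈⟨ solve 4 (λ x y x′ y′ →
             x′ :* y :+ y′ :* (con (pos 1) :- x) :=
             (con (pos 1) :- x) :- ((x :- con (pos 1)) :* (y′ :- con (pos 1)) :- y :* x′))
             refl (X n) (Y n) (X (suc n)) (Y (suc n)) ⟩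
      (1# - X n) - ((X n - 1#) * (Y (suc n) - 1#) - Y n * X (suc n))
        ≈⟨ +-congˡ (-‿cong (trans (sym D≈det) D≈0)) ⟩
      (1# - X n) - 0#
        ≈⟨ solve 1 (λ x → (con (pos 1) :- x) :- con (pos 0) := con (pos 1) :- x) refl (X n) ⟩
      1# - X n ∎

  Root⇒fixed : ∀ {x} → Root x → X n * x + Y n * σ x ≈ x
  Root⇒fixed {x} root = trans (sym (orbit-linear x (σ x) n)) (trans (orbit-root (Root⇒σ² root) n) (σⁿ x))

  Root⇒fixed-suc : ∀ {x} → Root x → X (suc n) * x + Y (suc n) * σ x ≈ σ x
  Root⇒fixed-suc {x} root = trans (sym (orbit-linear x (σ x) (suc n)))
    (trans (orbit-root (Root⇒σ² root) (suc n)) (φ-cong (σⁿ x)))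

  -- Cramer's rule: the first row of the adjugate of A - 1 is applied to (A - 1)(x , σx) = 0.
  Root⇒D≈0 : ∀ {x} → Root x → ¬ (x ≈ 0#) → D ≈ 0#
  Root⇒D≈0 {x} root x≉0 = *-zero-cancelʳ x≉0 (begin
    D * x
      ≈⟨ *-congʳ D≈det ⟩
    ((X n - 1#) * (Y (suc n) - 1#) - Y n * X (suc n)) * x
      ≈⟨ solve 6 (λ p q r s x y →
           ((p :- con (pos 1)) :* (s :- con (pos 1)) :- q :* r) :* x :=
           (s :- con (pos 1)) :* ((p :* x :+ q :* y) :- x) :- q :* ((r :* x :+ s :* y) :- y))
           refl (X n) (Y n) (X (suc n)) (Y (suc n)) x (σ x) ⟩
    (Y (suc n) - 1#) * ((X n * x + Y n * σ x) - x)
      - Y n * ((X (suc n) * x + Y (suc n) * σ x) - σ x)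
      ≈⟨ +-cong (*-congˡ (x≈y⇒x∙y⁻¹≈ε (Root⇒fixed root)))
                (-‿cong (*-congˡ (x≈y⇒x∙y⁻¹≈ε (Root⇒fixed-suc root)))) ⟩
    (Y (suc n) - 1#) * 0# - Y n * 0#
      ≈⟨ solve 2 (λ s q → (s :- con (pos 1)) :* con (pos 0) :- q :* con (pos 0) := con (pos 0)) refl _ _ ⟩
    0# ∎)

  -- The σ-Wronskian and the size of the root space.

  W : Carrier → Carrier → Carrier
  W x y = x * σ y - y * σ x

  W-cong : ∀ {x x′ y y′} → x ≈ x′ → y ≈ y′ → W x y ≈ W x′ y′
  W-cong x≈ y≈ = +-cong (*-cong x≈ (φ-cong y≈)) (-‿cong (*-cong y≈ (φ-cong x≈)))

  -- The analogue of Abel's identity: the β-terms cancel, and all values of `W` on roots solve the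
  -- same first-order equation.
  σ-W : ∀ {x y} → Root x → Root y → σ (W x y) ≈ α * W x y
  σ-W {x} {y} rx ry = begin
    σ (x * σ y - y * σ x)
      ≈⟨ trans (φ-sub _ _) (+-cong (φ-* _ _) (-‿cong (φ-* _ _))) ⟩
    σ x * σ (σ y) - σ y * σ (σ x)
      ≈⟨ +-cong (*-congˡ (Root⇒σ² ry)) (-‿cong (*-congˡ (Root⇒σ² rx))) ⟩
    σ x * (- (β * σ y) - α * y) - σ y * (- (β * σ x) - α * x)
      ≈⟨ solve 6 (λ α β x y x′ y′ →
           x′ :* (:- (β :* y′) :- α :* y) :- y′ :* (:- (β :* x′) :- α :* x) :=
           α :* (x :* y′ :- y :* x′)) refl α β x y (σ x) (σ y) ⟩
    α * W x y ∎

  module _ {x₀} (root₀ : Root x₀) (x₀≉0 : ¬ (x₀ ≈ 0#)) where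

    Split⇒independent : Split → ∃ λ x → Root x × ¬ (W x₀ x ≈ 0#)
    Split⇒independent (h₀ , h₁) =
      -- When A is the identity every vector is fixed. With f = - σx₀ and g = x₀ the form f x + g σx
      -- is `W x₀ x`, and on (0 , 1) it takes the value x₀ ≠ 0.
      let (x , root , value≉0) = descent 0# 1#
            (Split⇒orbit Yₙ≈0 Yₙ₊₁≈1 0# 1#) (Split⇒orbit-suc Yₙ≈0 Yₙ₊₁≈1 0# 1#) (- σ x₀) x₀
            (λ eq → x₀≉0 (trans
              (solve 2 (λ x y → x := (:- y) :* con (pos 0) :+ x :* con (pos 1)) refl x₀ (σ x₀)) eq)) in
      x , root , λ eq → value≉0 (trans
        (solve 4 (λ u v x y → (:- v) :* x :+ u :* y := u :* y :- x :* v) refl x₀ (σ x₀) x (σ x)) eq)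
      where
      Yₙ≈0   = trans (sym H-pred≈Y) h₀
      Yₙ₊₁≈1 = trans (sym (H≈Y n)) h₁

    -- The roots are the fixed multiples of x₀. The singleton of 0 serves as a dummy first factor,
    -- so that `HasExactly-product` does the counting.
    line : (∀ x → Root x → W x₀ x ≈ 0#) → HasExactly q Root
    line dependent = ≡.subst (λ m → HasExactly m Root) (ℕ.*-identityˡ q)
      (HasExactly-product {f = λ y μ → y + μ * x₀}
        (λ y≈ μ≈ → +-cong y≈ (*-congʳ μ≈))
        (λ {y} {μ} y≈0 fμ → trans
          (Lmap-cong (trans (+-congʳ y≈0)
            (solve 2 (λ μ x → con (pos 0) :+ μ :* x := μ :* x :+ con (pos 0) :* x) refl μ x₀)))
          (Root-combination fμ φ-0 root₀ root₀))
        (λ {y} {y′} {μ} {μ′} y≈0 y′≈0 _ _ eq → trans y≈0 (sym y′≈0) ,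
          *-cancelˡ-nonzero x₀≉0 (trans (*-comm x₀ μ) (trans
            (+-cancelˡ y (μ * x₀) (μ′ * x₀) (trans eq (+-congʳ (trans y′≈0 (sym y≈0)))))
            (*-comm μ′ x₀))))
        onto (HasExactly-singleton 0#) fixed-field)
      where
      onto : ∀ x → Root x → ∃₂ λ y μ → y ≈ 0# × σ μ ≈ μ × x ≈ y + μ * x₀
      onto x root = 0# , μ , refl , σμ≈μ , trans (sym μx₀≈x) (sym (+-identityˡ _))
        where
        x₀⁻¹ = proj₁ (inverse x₀ x₀≉0)
        μ = x * x₀⁻¹

        μx₀≈x : μ * x₀ ≈ x
        μx₀≈x = begin
          x * x₀⁻¹ * x₀    ≈⟨ solve 3 (λ x i y → x :* i :* y := x :* (y :* i)) refl x x₀⁻¹ x₀ ⟩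
          x * (x₀ * x₀⁻¹)  ≈⟨ *-congˡ (proj₂ (inverse x₀ x₀≉0)) ⟩
          x * 1#           ≈⟨ *-identityʳ x ⟩
          x                ∎

        σμ≈μ : σ μ ≈ μ
        -- Multiplied by x₀ σx₀, the difference σμ - μ becomes `W x₀ x`; so a vanishing `W` means a
        -- ratio fixed by σ.
        σμ≈μ = x∙y⁻¹≈ε⇒x≈y _ _ (*-zero-cancelʳ (*-nonzero x₀≉0 (λ eq → x₀≉0 (φ-injective (trans eq (sym φ-0))))) (begin
          (σ μ - μ) * (x₀ * σ x₀)
            ≈⟨ solve 4 (λ μ′ μ x y → (μ′ :- μ) :* (x :* y) := x :* (μ′ :* y) :- (μ :* x) :* y) refl _ _ _ _ ⟩
          x₀ * (σ μ * σ x₀) - (μ * x₀) * σ x₀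
            ≈⟨ +-congʳ (*-congˡ (sym (φ-* μ x₀))) ⟩
          W x₀ (μ * x₀)
            ≈⟨ W-cong refl μx₀≈x ⟩
          W x₀ x
            ≈⟨ dependent x root ⟩
          0# ∎))

  module _ {x₀ x₁} (root₀ : Root x₀) (root₁ : Root x₁) (W≉0 : ¬ (W x₀ x₁ ≈ 0#)) where

    private
      Δ = W x₀ x₁

      Δ⁻¹ = proj₁ (inverse Δ W≉0)

      ΔΔ⁻¹≈1 : Δ * Δ⁻¹ ≈ 1#
      ΔΔ⁻¹≈1 = proj₂ (inverse Δ W≉0)

    -- A fixes the vectors (xᵢ , σxᵢ), whose determinant is `W x₀ x₁`. Hence it is the identity, and
    -- Cramer's rule extracts its second column.
    independent⇒Split : Split
    independent⇒Split = trans H-pred≈Y Yₙ≈0 , trans (H≈Y n) Yₙ₊₁≈1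
      where
      Yₙ≈0 : Y n ≈ 0#
      Yₙ≈0 = *-zero-cancelʳ W≉0 (begin
        Y n * Δ
          ≈⟨ solve 6 (λ p q x y x′ y′ →
               q :* (x :* y′ :- y :* x′) :=
               x :* (p :* y :+ q :* y′) :- y :* (p :* x :+ q :* x′))
               refl (X n) (Y n) x₀ x₁ (σ x₀) (σ x₁) ⟩
        x₀ * (X n * x₁ + Y n * σ x₁) - x₁ * (X n * x₀ + Y n * σ x₀)
          ≈⟨ +-cong (*-congˡ (Root⇒fixed root₁)) (-‿cong (*-congˡ (Root⇒fixed root₀))) ⟩
        x₀ * x₁ - x₁ * x₀
          ≈⟨ x≈y⇒x∙y⁻¹≈ε (*-comm x₀ x₁) ⟩
        0# ∎)

      Yₙ₊₁≈1 : Y (suc n) ≈ 1#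
      Yₙ₊₁≈1 = *-cancelˡ-nonzero W≉0 (begin
        Δ * Y (suc n)
          ≈⟨ solve 6 (λ p q x y x′ y′ →
               (x :* y′ :- y :* x′) :* q :=
               x :* (p :* y :+ q :* y′) :- y :* (p :* x :+ q :* x′))
               refl (X (suc n)) (Y (suc n)) x₀ x₁ (σ x₀) (σ x₁) ⟩
        x₀ * (X (suc n) * x₁ + Y (suc n) * σ x₁) - x₁ * (X (suc n) * x₀ + Y (suc n) * σ x₀)
          ≈⟨ +-cong (*-congˡ (Root⇒fixed-suc root₁)) (-‿cong (*-congˡ (Root⇒fixed-suc root₀))) ⟩
        Δ
          ≈⟨ *-identityʳ Δ ⟨
        Δ * 1# ∎)

    -- The coordinates of a root with respect to x₀ and x₁ are quotients of values of `W`, by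
    -- Cramer's rule.
    plane : HasExactly (q ^ 2) Root
    plane = ≡.subst (λ m → HasExactly (q ℕ.* m) Root) (≡.sym (ℕ.*-identityʳ q))
      (HasExactly-product {f = λ μ ν → μ * x₀ + ν * x₁}
        (λ μ≈ ν≈ → +-cong (*-congʳ μ≈) (*-congʳ ν≈))
        (λ fμ fν → Root-combination fμ fν root₀ root₁)
        injective onto fixed-field fixed-field)
      where
      W-left : ∀ {μ ν} → σ μ ≈ μ → σ ν ≈ ν → W (μ * x₀ + ν * x₁) x₁ ≈ Δ * μ
      W-left {μ} {ν} fμ fν = begin
        (μ * x₀ + ν * x₁) * σ x₁ - x₁ * σ (μ * x₀ + ν * x₁)
          ≈⟨ +-congˡ (-‿cong (*-congˡ (trans (φ-+ _ _)
               (+-cong (trans (φ-* _ _) (*-congʳ fμ)) (trans (φ-* _ _) (*-congʳ fν)))))) ⟩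
        (μ * x₀ + ν * x₁) * σ x₁ - x₁ * (μ * σ x₀ + ν * σ x₁)
          ≈⟨ solve 6 (λ μ ν x y x′ y′ →
               (μ :* x :+ ν :* y) :* y′ :- y :* (μ :* x′ :+ ν :* y′) :=
               (x :* y′ :- y :* x′) :* μ) refl μ ν x₀ x₁ (σ x₀) (σ x₁) ⟩
        Δ * μ ∎

      W-right : ∀ {μ ν} → σ μ ≈ μ → σ ν ≈ ν → W x₀ (μ * x₀ + ν * x₁) ≈ Δ * ν
      W-right {μ} {ν} fμ fν = begin
        x₀ * σ (μ * x₀ + ν * x₁) - (μ * x₀ + ν * x₁) * σ x₀
          ≈⟨ +-congʳ (*-congˡ (trans (φ-+ _ _)
               (+-cong (trans (φ-* _ _) (*-congʳ fμ)) (trans (φ-* _ _) (*-congʳ fν))))) ⟩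
        x₀ * (μ * σ x₀ + ν * σ x₁) - (μ * x₀ + ν * x₁) * σ x₀
          ≈⟨ solve 6 (λ μ ν x y x′ y′ →
               x :* (μ :* x′ :+ ν :* y′) :- (μ :* x :+ ν :* y) :* x′ :=
               (x :* y′ :- y :* x′) :* ν) refl μ ν x₀ x₁ (σ x₀) (σ x₁) ⟩
        Δ * ν ∎

      injective : ∀ {μ μ′ ν ν′} → σ μ ≈ μ → σ μ′ ≈ μ′ → σ ν ≈ ν → σ ν′ ≈ ν′ →
        μ * x₀ + ν * x₁ ≈ μ′ * x₀ + ν′ * x₁ → μ ≈ μ′ × ν ≈ ν′
      injective fμ fμ′ fν fν′ eq =
          *-cancelˡ-nonzero W≉0 (trans (sym (W-left fμ fν)) (trans (W-cong eq refl) (W-left fμ′ fν′)))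
        , *-cancelˡ-nonzero W≉0 (trans (sym (W-right fμ fν)) (trans (W-cong refl eq) (W-right fμ′ fν′)))

      -- σ multiplies every W of two roots by α, so the ratio of two such values is fixed.
      ratio-fixed : ∀ {x y} → Root x → Root y → σ (W x y * Δ⁻¹) ≈ W x y * Δ⁻¹
      ratio-fixed {x} {y} rx ry = *-cancelˡ-nonzero (*-nonzero α≉0 W≉0) (begin
        α * Δ * σ (W x y * Δ⁻¹)     ≈⟨ *-congʳ (σ-W root₀ root₁) ⟨
        σ Δ * σ (W x y * Δ⁻¹)       ≈⟨ φ-* _ _ ⟨
        σ (Δ * (W x y * Δ⁻¹))       ≈⟨ φ-cong Δ*ratio ⟩
        σ (W x y)                   ≈⟨ σ-W rx ry ⟩
        α * W x y                   ≈⟨ *-congˡ Δ*ratio ⟨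
        α * (Δ * (W x y * Δ⁻¹))     ≈⟨ *-assoc _ _ _ ⟨
        α * Δ * (W x y * Δ⁻¹)       ∎)
        where
        Δ*ratio : Δ * (W x y * Δ⁻¹) ≈ W x y
        Δ*ratio = begin
          Δ * (W x y * Δ⁻¹)  ≈⟨ solve 3 (λ d w i → d :* (w :* i) := w :* (d :* i)) refl Δ (W x y) Δ⁻¹ ⟩
          W x y * (Δ * Δ⁻¹)  ≈⟨ *-congˡ ΔΔ⁻¹≈1 ⟩
          W x y * 1#         ≈⟨ *-identityʳ _ ⟩
          W x y              ∎

      onto : ∀ x → Root x → ∃₂ λ μ ν → σ μ ≈ μ × σ ν ≈ ν × x ≈ μ * x₀ + ν * x₁
      onto x root = W x x₁ * Δ⁻¹ , W x₀ x * Δ⁻¹ , ratio-fixed root root₁ , ratio-fixed root₀ root , (begin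
        x
          ≈⟨ *-identityʳ x ⟨
        x * 1#
          ≈⟨ *-congˡ ΔΔ⁻¹≈1 ⟨
        x * (Δ * Δ⁻¹)
          -- Expansion of the vanishing 3 × 3 determinant with rows (x , x₀ , x₁), the same row
          -- again, and the row of σ-images.
          ≈⟨ solve 7 (λ x y z x′ y′ z′ i →
               x :* ((y :* z′ :- z :* y′) :* i) :=
               (x :* z′ :- z :* x′) :* i :* y :+ (y :* x′ :- x :* y′) :* i :* z)
               refl x x₀ x₁ (σ x) (σ x₀) (σ x₁) Δ⁻¹ ⟩
        W x x₁ * Δ⁻¹ * x₀ + W x₀ x * Δ⁻¹ * x₁ ∎)

  -- Classification by dimension and the three equivalences.

  data Classification : Set (c ⊔ ℓ) where
    trivial : HasExactly 1 Root → ¬ (D ≈ 0#) → ¬ Split → Classification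
    one-dim : HasExactly q Root → D ≈ 0# → ¬ Split → Classification
    two-dim : HasExactly (q ^ 2) Root → D ≈ 0# → Split → Classification

  -- Two finite searches, for a non-zero root and then for one independent of it, settle the root
  -- count, `D` and `Split` together. All six implications can then be read off, since 1 < q < q²
  -- keeps the counts apart.
  classify : Classification
  classify with ∃? all-elements
    (λ x → (Lmap σ a b c′ x ≈? 0#) Dec.×-dec Dec.¬? (x ≈? 0#))
    (λ x≈y (root , x≉0) → trans (Lmap-cong (sym x≈y)) root , x≉0 ∘ trans x≈y)
  ... | no none = trivial
    (HasExactly-resp (HasExactly-singleton 0#)
      (λ x x≈0 → trans (Lmap-cong x≈0) Root-0)
      (λ x root → Dec.decidable-stable (x ≈? 0#) (λ x≉0 → none (x , root , x≉0))))
    (none ∘ D≈0⇒Root)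
    (none ∘ D≈0⇒Root ∘ Split⇒D≈0)
  ... | yes (x₀ , root₀ , x₀≉0) with ∃? all-elements
    (λ x → (Lmap σ a b c′ x ≈? 0#) Dec.×-dec Dec.¬? (W x₀ x ≈? 0#))
    (λ x≈y (root , W≉0) → trans (Lmap-cong (sym x≈y)) root , W≉0 ∘ trans (W-cong refl x≈y))
  ...   | no none = one-dim
    (line root₀ x₀≉0 (λ x root → Dec.decidable-stable (W x₀ x ≈? 0#) (λ W≉0 → none (x , root , W≉0))))
    (Root⇒D≈0 root₀ x₀≉0)
    (none ∘ Split⇒independent root₀ x₀≉0)
  ...   | yes (x₁ , root₁ , W≉0) = two-dim
    (plane root₀ root₁ W≉0)
    (Root⇒D≈0 root₀ x₀≉0)
    (independent⇒Split root₀ root₁ W≉0)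

theorem9 : ∀ {c ℓ} (R : CommutativeRing c ℓ) (q n : ℕ) →
    IsPrimePower q → 2 ≤ n →
    Setup.IsFiniteFieldOfSize R (q ^ n) →
    (σ : CommutativeRing.Carrier R → CommutativeRing.Carrier R) →
    Setup.IsGaloisGenerator R q n σ →
    (a b c' ci : CommutativeRing.Carrier R) →
    ¬ (CommutativeRing._≈_ R (CommutativeRing._*_ R a c') (CommutativeRing.0# R)) →
    CommutativeRing._≈_ R (CommutativeRing._*_ R c' ci) (CommutativeRing.1# R) →
    let open CommutativeRing R
        roots = λ (m : ℕ) → Setup.HasExactly R m (λ x → Setup.Lmap R σ a b c' x ≈ 0#)
        condI = (Setup.H R σ a b ci (pred n) ≈ 0#) × (Setup.H R σ a b ci n ≈ 1#)
        D = 1# - Setup.E R σ a b ci n + Setup.norm R σ n (a * ci)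
    in (roots (q ^ 2) ⇔ condI)
     × (roots q ⇔ ((D ≈ 0#) × ¬ condI))
     × (roots 1 ⇔ (¬ (D ≈ 0#)))
theorem9 R q n q-power 2≤n finite σ galois a b c' ci ac≉0 c*ci≈1 = conclude classify
  where
  open Roots R q n 2≤n finite σ galois a b c' ci ac≉0 c*ci≈1
  open Counting R

  1<q : 1 < q
  1<q = primePower>1 q-power

  q<q² : q < q ^ 2
  q<q² = ≡.subst (_< q ^ 2) (ℕ.^-identityʳ q) (ℕ.^-monoʳ-< q 1<q {1} {2} ℕ.≤-refl)

  clash : ∀ {p k m} {A : Set p} → k < m →
    Setup.HasExactly R k Root → Setup.HasExactly R m Root → A
  clash k<m p p′ = ⊥-elim (ℕ.<-irrefl (HasExactly-unique p p′ (λ _ r → r) (λ _ r → r)) k<m)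

  conclude : Classification → _
  conclude (trivial one D≉0 ¬split) =
      mk⇔ (clash (ℕ.<-trans 1<q q<q²) one) (⊥-elim ∘ ¬split)
    , mk⇔ (clash 1<q one) (⊥-elim ∘ D≉0 ∘ proj₁)
    , mk⇔ (λ _ → D≉0) (λ _ → one)
  conclude (one-dim line D≈0 ¬split) =
      mk⇔ (clash q<q² line) (⊥-elim ∘ ¬split)
    , mk⇔ (λ _ → D≈0 , ¬split) (λ _ → line)
    , mk⇔ (λ one → clash 1<q one line) (λ D≉0 → ⊥-elim (D≉0 D≈0))
  conclude (two-dim plane D≈0 split) =
      mk⇔ (λ _ → split) (λ _ → plane)
    , mk⇔ (λ line → clash q<q² line plane) (λ (_ , ¬split) → ⊥-elim (¬split split))
    , mk⇔ (λ one → clash (ℕ.<-trans 1<q q<q²) one plane) (λ D≉0 → ⊥-elim (D≉0 D≈0))
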